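{- Let $\Gamma$ and $\tilde\Gamma$ be two generalized cospectral signed bipartite graphs on $n$ vertices with a common characteristic polynomial $\phi(x)$ that is irreducible over $\mathbb{Q}$. Suppose their adjacency matrices (with vertices ordered according to the bipartitions) are $$A=A(\Gamma)=\begin{bmatrix} O & M\\ M^{\mathrm T} & O\end{bmatrix},\qquad \tilde A=A(\tilde\Gamma)=\begin{bmatrix} O & \tilde M\\ \tilde M^{\mathrm T} & O\end{bmatrix}.$$ Then there exists a regular orthogonal matrix $Q$ with $Q^{\mathrm T}AQ=\tilde A$ of the form $$Q=\begin{bmatrix} Q_1 & O\\ O & Q_2\end{bmatrix}\quad\text{or}\quad Q=\begin{bmatrix} O & Q_1\\ Q_2 & O\end{bmatrix},$$ where $Q_1$ and $Q_2$ are regular rational orthogonal matrices.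
   Context: A signed graph is a simple graph $G=(V,E)$ with a sign map $\sigma:E\to\{1,-1\}$; its adjacency matrix has $(i,j)$-entry $\sigma(ij)$ if $ij\in E$ and $0$ otherwise. A signed bipartite graph is a signed graph whose underlying graph is bipartite. Two signed graphs $\Gamma,\tilde\Gamma$ are generalized cospectral if $\det(xI-A(\Gamma))=\det(xI-A(\tilde\Gamma))$ and $\det(xI-(J-I-A(\Gamma)))=\det(xI-(J-I-A(\tilde\Gamma)))$, where $J$ is the all-ones matrix. A square matrix $Q$ is orthogonal if $Q^{\mathrm T}Q=I$, rational if all its entries are rational, and regular if $Qe=e$, where $e$ is the all-ones column vector. -}

module Defs where

open import Data.Nat using (ℕ; zero; suc; _≤_; _+_)
open import Data.Fin using (Fin; zero; suc; splitAt; punchIn; _≟_)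
open import Data.Sum using (_⊎_; inj₁; inj₂)
open import Data.Product using (_×_; ∃-syntax)
open import Data.List using (List; []; _∷_)
open import Data.Rational using (ℚ; 0ℚ; 1ℚ; -_) renaming (_+_ to _+ℚ_; _*_ to _*ℚ_; _-_ to _-ℚ_)
open import Relation.Nullary using (¬_; yes; no)
open import Relation.Binary.PropositionalEquality using (_≡_)

Mat : ℕ → ℕ → Set
Mat m n = Fin m → Fin n → ℚ

Σℚ : ∀ {n} → (Fin n → ℚ) → ℚ
Σℚ {zero}  f = 0ℚ
Σℚ {suc n} f = f zero +ℚ Σℚ (λ i → f (suc i))

_⊗_ : ∀ {m k n} → Mat m k → Mat k n → Mat m n
(A ⊗ B) i j = Σℚ (λ l → A i l *ℚ B l j)

_ᵀ : ∀ {m n} → Mat m n → Mat n m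
(A ᵀ) i j = A j i

δ : ∀ {n} → Fin n → Fin n → ℚ
δ i j with i ≟ j
... | yes _ = 1ℚ
... | no  _ = 0ℚ

I : ∀ {n} → Mat n n
I = δ

O : ∀ {m n} → Mat m n
O _ _ = 0ℚ

J : ∀ {m n} → Mat m n
J _ _ = 1ℚ

_≈M_ : ∀ {m n} → Mat m n → Mat m n → Set
A ≈M B = ∀ i j → A i j ≡ B i j

block : ∀ {m₁ m₂ n₁ n₂} → Mat m₁ n₁ → Mat m₁ n₂ → Mat m₂ n₁ → Mat m₂ n₂
      → Mat (m₁ + m₂) (n₁ + n₂)
block {m₁} {m₂} {n₁} {n₂} A B C D i j with splitAt m₁ i | splitAt n₁ j
... | inj₁ r | inj₁ c = A r c
... | inj₁ r | inj₂ c = B r c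
... | inj₂ r | inj₁ c = C r c
... | inj₂ r | inj₂ c = D r c

Regular : ∀ {m n} → Mat m n → Set
Regular Q = ∀ i → Σℚ (λ j → Q i j) ≡ 1ℚ

-- Q is orthogonal: QᵀQ = I and QQᵀ = I
-- (the two-sided condition forces the matrix to be square; for square
-- matrices it is equivalent to QᵀQ = I)
Orthogonal : ∀ {m n} → Mat m n → Set
Orthogonal Q = ((Q ᵀ) ⊗ Q) ≈M I × (Q ⊗ (Q ᵀ)) ≈M I

-- Polynomials over ℚ as coefficient lists (lowest degree first)

Poly : Set
Poly = List ℚ

coeff : Poly → ℕ → ℚ
coeff []       _       = 0ℚ
coeff (a ∷ p)  zero    = a
coeff (a ∷ p)  (suc k) = coeff p k

_≈P_ : Poly → Poly → Set
p ≈P q = ∀ k → coeff p k ≡ coeff q k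

_+P_ : Poly → Poly → Poly
[]      +P q       = q
(a ∷ p) +P []      = a ∷ p
(a ∷ p) +P (b ∷ q) = (a +ℚ b) ∷ (p +P q)

scale : ℚ → Poly → Poly
scale c []      = []
scale c (a ∷ p) = (c *ℚ a) ∷ scale c p

_*P_ : Poly → Poly → Poly
[]      *P q = []
(a ∷ p) *P q = scale a q +P (0ℚ ∷ (p *P q))

negP : Poly → Poly
negP = scale (- 1ℚ)

constP : ℚ → Poly
constP c = c ∷ []

X : Poly
X = 0ℚ ∷ 1ℚ ∷ []

NonConstant : Poly → Set
NonConstant p = ∃[ k ] (1 ≤ k × ¬ (coeff p k ≡ 0ℚ))

IrreducibleQ : Poly → Set
IrreducibleQ p = NonConstant p
  × (∀ g h → p ≈P (g *P h) → ¬ (NonConstant g × NonConstant h))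

ΣP : ∀ {n} → (Fin n → Poly) → Poly
ΣP {zero}  f = []
ΣP {suc n} f = f zero +P ΣP (λ i → f (suc i))

altΣP : ∀ {n} → (Fin n → Poly) → Poly
altΣP {zero}  f = []
altΣP {suc n} f = f zero +P negP (altΣP (λ i → f (suc i)))

det : ∀ {n} → (Fin n → Fin n → Poly) → Poly
det {zero}  M = constP 1ℚ
det {suc n} M = altΣP (λ j → M zero j *P det (λ r c → M (suc r) (punchIn j c)))

charPoly : ∀ {n} → Mat n n → Poly
charPoly A = det (λ i j → (constP (δ i j) *P X) +P constP (- A i j))

JIA : ∀ {n} → Mat n n → Mat n n
JIA A i j = (1ℚ -ℚ δ i j) -ℚ A i j

GenCospectral : ∀ {n m} → Mat n n → Mat m m → Set
GenCospectral A B = charPoly A ≈P charPoly B × charPoly (JIA A) ≈P charPoly (JIA B)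

-- Signed bipartite graphs, vertices ordered by the bipartition:
-- the adjacency matrix is [[O , M] , [Mᵀ , O]] with M a (-1,0,1)-matrix.

SignEntry : ℚ → Set
SignEntry x = x ≡ 0ℚ ⊎ x ≡ 1ℚ ⊎ x ≡ - 1ℚ

SignMat : ∀ {m n} → Mat m n → Set
SignMat M = ∀ i j → SignEntry (M i j)

bipAdj : ∀ {n₁ n₂} → Mat n₁ n₂ → Mat (n₁ + n₂) (n₁ + n₂)
bipAdj M = block O M (M ᵀ) O

{-# OPTIONS --safe #-}

-- Write e for the all-ones vector and A, B for the two adjacency matrices, with common
-- characteristic polynomial φ of degree n.
--
-- Cramer's rule for (xI − A) w = φ e yields φ(A)e = 0 and expresses the coefficients of eᵀw
-- through the moments eᵀAᵏe.  Since det(xI − A + J) = φ + eᵀw, and this determinant is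
-- obtained from the complementary characteristic polynomial by x ↦ −1 − x, generalized
-- cospectrality makes the moments of A and B agree.
--
-- As φ is irreducible of degree n, p ↦ p(A)e and p ↦ p(B)e are isomorphisms from the field
-- ℚ[x]/(φ) onto ℚⁿ.  By equality of moments, p(B)e ↦ p(A)e is an isometry Q, which carries
-- B to A and fixes e.
--
-- Bipartiteness gives diagonal sign matrices S, T with SA = −AS and TB = −BT.  Write
-- Se = f(A)e and Te = g(B)e.  Orthogonality of S and T says eᵀq(A)e = eᵀq(−A)f(A)²e for all q,
-- and likewise for B and g, so f² = g² in the field and f = ±g.  Hence SQ = ±QT, which
-- is the block form.
module Submission where

open import Defs
open import Algebra.Bundles using (CommutativeRing)
open import Data.Empty using (⊥; ⊥-elim)
open import Data.Fin using (Fin; zero; suc; toℕ; fromℕ<; punchIn; lift; splitAt; _↑ˡ_; _↑ʳ_; _≟_)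
open import Data.Fin.Properties using (any?; splitAt-↑ˡ; splitAt-↑ʳ; splitAt⁻¹-↑ˡ; splitAt⁻¹-↑ʳ)
open import Data.List using ([]; _∷_; drop; length; tabulate)
open import Data.Maybe using (Maybe; just; nothing)
open import Data.Nat using (ℕ; zero; suc; _+_; _⊔_; _≤_; z≤n; s≤s; _≤?_)
open import Data.Nat.Properties using (≤-refl; ≤-trans; ≰⇒>; n≤1+n; m≤n⇒m≤1+n; m≤n⇒m<n∨m≡n; m≤n+m; m≤m⊔n; m≤n⊔m; +-suc; +-comm; +-monoʳ-≤)
open import Data.Product using (_×_; _,_; proj₁; proj₂; ∃-syntax; Σ-syntax)
open import Data.Rational using (ℚ; 0ℚ; 1ℚ; ½; -_; 1/_; ≢-nonZero) renaming (_+_ to _+ℚ_; _*_ to _*ℚ_; _-_ to _-ℚ_; _≤_ to _≤ℚ_; _≟_ to _≟ℚ_)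
import Data.Rational.Properties as ℚₚ
open import Data.Sum as Sum using (_⊎_; inj₁; inj₂)
open import Data.Vec.Functional using (insertAt)
open import Data.Vec.Functional.Properties using (insertAt-lookup; insertAt-punchIn)
open import Level using (0ℓ)
open import Relation.Binary.PropositionalEquality
import Relation.Binary.Reasoning.Setoid as SetoidReasoning
open import Relation.Nullary using (yes; no)
open import Relation.Nullary.Decidable using (¬?; decidable-stable; dec⇒maybe)
open import Tactic.RingSolver using (solve-∀)
open import Tactic.RingSolver.Core.AlmostCommutativeRing using (AlmostCommutativeRing; fromCommutativeRing)

-- The polynomial ring

-- The pairing (p, q) ↦ eᵀp(A)q(A)e depends only on the moments, so it is the same for A and B. This
-- is how the two sign matrices become comparable: T is given by g on the side of B, S by f on the
-- side of A, and both polynomials are read in one field. The step from the moment identities to f²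
-- = g² is nondegeneracy of the pairing: with q(-x) in place of q they say eᵀr(A)(f² - g²)(A)e = 0
-- for every r, and an r for which r(A)e is a standard basis vector isolates one coordinate. On the
-- determinant side, adj(xI - A)e is not assembled from cofactors. It consists of the values on unit
-- rows of a linear functional, the derivative of the determinant under a rank-one update, which
-- takes the value φ on every row of xI - A. Equality of the block sizes of the two graphs is a
-- conclusion: the blocks of Q turn out to be orthogonal, hence square.

ℚ-ring : AlmostCommutativeRing 0ℓ 0ℓ
ℚ-ring = fromCommutativeRing ℚₚ.+-*-commutativeRing (λ x → dec⇒maybe (0ℚ ≟ℚ x))

-- A record, unlike the function type p ≈P q, lets p and q be inferred.
infix 4 _≋_
record _≋_ (p q : Poly) : Set where
  constructor pw
  field at : p ≈P q
open _≋_

≋-refl : ∀ {p} → p ≋ p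
≋-refl = pw λ k → refl

≋-sym : ∀ {p q} → p ≋ q → q ≋ p
≋-sym e = pw λ k → sym (at e k)

≋-trans : ∀ {p q r} → p ≋ q → q ≋ r → p ≋ r
≋-trans e f = pw λ k → trans (at e k) (at f k)

∷-cong : ∀ {a b p q} → a ≡ b → p ≋ q → (a ∷ p) ≋ (b ∷ q)
∷-cong e f = pw λ { zero → e ; (suc k) → at f k }

tail-≋ : ∀ {a b p q} → (a ∷ p) ≋ (b ∷ q) → p ≋ q
tail-≋ e = pw λ k → at e (suc k)

-- Coefficient lists are not normalised: lists that differ by trailing zeros represent the same
-- polynomial.
0∷[]≋ : (0ℚ ∷ []) ≋ []
0∷[]≋ = pw λ { zero → refl ; (suc k) → refl }

coeff-+ : ∀ p q k → coeff (p +P q) k ≡ coeff p k +ℚ coeff q k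
coeff-+ []      q       k       = sym (ℚₚ.+-identityˡ _)
coeff-+ (a ∷ p) []      k       = sym (ℚₚ.+-identityʳ _)
coeff-+ (a ∷ p) (b ∷ q) zero    = refl
coeff-+ (a ∷ p) (b ∷ q) (suc k) = coeff-+ p q k

coeff-scale : ∀ c p k → coeff (scale c p) k ≡ c *ℚ coeff p k
coeff-scale c []      k       = sym (ℚₚ.*-zeroʳ c)
coeff-scale c (a ∷ p) zero    = refl
coeff-scale c (a ∷ p) (suc k) = coeff-scale c p k

coeff-neg : ∀ p k → coeff (negP p) k ≡ - coeff p k
coeff-neg p k = trans (coeff-scale (- 1ℚ) p k) (lemma (coeff p k))
  where
  lemma : ∀ x → (- 1ℚ) *ℚ x ≡ - x
  lemma = solve-∀ ℚ-ring

+P-cong : ∀ {p p′ q q′} → p ≋ p′ → q ≋ q′ → (p +P q) ≋ (p′ +P q′)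
+P-cong {p} {p′} {q} {q′} e f = pw λ k →
  trans (coeff-+ p q k) (trans (cong₂ _+ℚ_ (at e k) (at f k)) (sym (coeff-+ p′ q′ k)))

+P-comm : ∀ p q → (p +P q) ≋ (q +P p)
+P-comm p q = pw λ k → trans (coeff-+ p q k)
  (trans (ℚₚ.+-comm (coeff p k) (coeff q k)) (sym (coeff-+ q p k)))

+P-assoc : ∀ p q r → ((p +P q) +P r) ≋ (p +P (q +P r))
+P-assoc p q r = pw λ k → begin
  coeff ((p +P q) +P r) k                   ≡⟨ coeff-+ (p +P q) r k ⟩
  coeff (p +P q) k +ℚ coeff r k             ≡⟨ cong (_+ℚ coeff r k) (coeff-+ p q k) ⟩
  (coeff p k +ℚ coeff q k) +ℚ coeff r k     ≡⟨ ℚₚ.+-assoc (coeff p k) (coeff q k) (coeff r k) ⟩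
  coeff p k +ℚ (coeff q k +ℚ coeff r k)     ≡⟨ cong (coeff p k +ℚ_) (coeff-+ q r k) ⟨
  coeff p k +ℚ coeff (q +P r) k             ≡⟨ coeff-+ p (q +P r) k ⟨
  coeff (p +P (q +P r)) k                   ∎
  where open ≡-Reasoning

+P-identityʳ : ∀ p → (p +P []) ≋ p
+P-identityʳ p = pw λ k → trans (coeff-+ p [] k) (ℚₚ.+-identityʳ _)

+P-inverseʳ : ∀ p → (p +P negP p) ≋ []
+P-inverseʳ p = pw λ k → trans (coeff-+ p (negP p) k)
  (trans (cong (coeff p k +ℚ_) (coeff-neg p k)) (ℚₚ.+-inverseʳ (coeff p k)))

scale-cong : ∀ {c d p q} → c ≡ d → p ≋ q → scale c p ≋ scale d q
scale-cong {c} {d} {p} {q} e f = pw λ k →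
  trans (coeff-scale c p k) (trans (cong₂ _*ℚ_ e (at f k)) (sym (coeff-scale d q k)))

scale-distribˡ : ∀ c p q → scale c (p +P q) ≋ (scale c p +P scale c q)
scale-distribˡ c []      q       = ≋-refl
scale-distribˡ c (a ∷ p) []      = ≋-refl
scale-distribˡ c (a ∷ p) (b ∷ q) = ∷-cong (ℚₚ.*-distribˡ-+ c a b) (scale-distribˡ c p q)

scale-distribʳ : ∀ c d p → scale (c +ℚ d) p ≋ (scale c p +P scale d p)
scale-distribʳ c d []      = ≋-refl
scale-distribʳ c d (a ∷ p) = ∷-cong (ℚₚ.*-distribʳ-+ a c d) (scale-distribʳ c d p)

scale-assoc : ∀ c d p → scale c (scale d p) ≋ scale (c *ℚ d) p
scale-assoc c d []      = ≋-refl
scale-assoc c d (a ∷ p) = ∷-cong (sym (ℚₚ.*-assoc c d a)) (scale-assoc c d p)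

scale-1 : ∀ p → scale 1ℚ p ≋ p
scale-1 []      = ≋-refl
scale-1 (a ∷ p) = ∷-cong (ℚₚ.*-identityˡ a) (scale-1 p)

scale-0 : ∀ p → scale 0ℚ p ≋ []
scale-0 p = pw λ k → trans (coeff-scale 0ℚ p k) (ℚₚ.*-zeroˡ (coeff p k))

+P-interchange : ∀ p q r s → ((p +P q) +P (r +P s)) ≋ ((p +P r) +P (q +P s))
+P-interchange p q r s =
  ≋-trans (+P-assoc p q (r +P s))
  (≋-trans (+P-cong (≋-refl {p})
      (≋-trans (≋-sym (+P-assoc q r s)) (≋-trans (+P-cong (+P-comm q r) ≋-refl) (+P-assoc r q s))))
  (≋-sym (+P-assoc p r (q +P s))))




*P-distribʳ : ∀ r p q → ((p +P q) *P r) ≋ ((p *P r) +P (q *P r))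
*P-distribʳ r []      q       = ≋-refl
*P-distribʳ r (a ∷ p) []      = ≋-sym (+P-identityʳ _)
*P-distribʳ r (a ∷ p) (b ∷ q) =
  ≋-trans (+P-cong (scale-distribʳ a b r) (∷-cong (sym (ℚₚ.+-identityˡ 0ℚ)) (*P-distribʳ r p q)))
          (+P-interchange (scale a r) (scale b r) (0ℚ ∷ (p *P r)) (0ℚ ∷ (q *P r)))

*P-congʳ : ∀ p {q q′} → q ≋ q′ → (p *P q) ≋ (p *P q′)
*P-congʳ []      e = ≋-refl
*P-congʳ (a ∷ p) e = +P-cong (scale-cong refl e) (∷-cong refl (*P-congʳ p e))

-- Any list of zeros represents 0. This covers the case of `*P-congˡ` in which two equal left
-- factors are lists of different lengths.
*P-zeroˡ : ∀ p q → p ≋ [] → (p *P q) ≋ []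
*P-zeroˡ []      q e = ≋-refl
*P-zeroˡ (a ∷ p) q e =
  ≋-trans (+P-cong (≋-trans (scale-cong (at e zero) ≋-refl) (scale-0 q))
                   (∷-cong refl (*P-zeroˡ p q (pw λ k → at e (suc k)))))
          0∷[]≋

*P-congˡ : ∀ {p p′} q → p ≋ p′ → (p *P q) ≋ (p′ *P q)
*P-congˡ {[]}    {p′}     q e = ≋-sym (*P-zeroˡ p′ q (≋-sym e))
*P-congˡ {a ∷ p} {[]}     q e = *P-zeroˡ (a ∷ p) q e
*P-congˡ {a ∷ p} {b ∷ p′} q e =
  +P-cong (scale-cong (at e zero) ≋-refl) (∷-cong refl (*P-congˡ q (tail-≋ e)))

*P-cong : ∀ {p p′ q q′} → p ≋ p′ → q ≋ q′ → (p *P q) ≋ (p′ *P q′)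
*P-cong {p} {p′} {q} {q′} e f = ≋-trans (*P-congˡ q e) (*P-congʳ p′ f)

*P-[] : ∀ p → (p *P []) ≋ []
*P-[] []      = ≋-refl
*P-[] (a ∷ p) = ≋-trans (∷-cong refl (*P-[] p)) 0∷[]≋

-- The product recurses on its left factor; this mirror recursion on the right factor is what makes
-- commutativity an induction.
*P-∷ : ∀ p b q → (p *P (b ∷ q)) ≋ (scale b p +P (0ℚ ∷ (p *P q)))
*P-∷ []      b q = ≋-sym 0∷[]≋
*P-∷ (a ∷ p) b q = ∷-cong (cong (_+ℚ 0ℚ) (ℚₚ.*-comm a b))
  (≋-trans (+P-cong (≋-refl {scale a q}) (*P-∷ p b q))
  (≋-trans (≋-sym (+P-assoc (scale a q) (scale b p) (0ℚ ∷ (p *P q))))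
  (≋-trans (+P-cong (+P-comm (scale a q) (scale b p)) ≋-refl)
           (+P-assoc (scale b p) (scale a q) (0ℚ ∷ (p *P q))))))

*P-comm : ∀ p q → (p *P q) ≋ (q *P p)
*P-comm []      q = ≋-sym (*P-[] q)
*P-comm (a ∷ p) q =
  ≋-trans (+P-cong (≋-refl {scale a q}) (∷-cong refl (*P-comm p q))) (≋-sym (*P-∷ q a p))

scale-*P : ∀ c p q → (scale c p *P q) ≋ scale c (p *P q)
scale-*P c []      q = ≋-refl
scale-*P c (a ∷ p) q =
  ≋-trans (+P-cong (≋-sym (scale-assoc c a q)) (∷-cong (sym (ℚₚ.*-zeroʳ c)) (scale-*P c p q)))
          (≋-sym (scale-distribˡ c (scale a q) (0ℚ ∷ (p *P q))))

0∷-*P : ∀ p q → ((0ℚ ∷ p) *P q) ≋ (0ℚ ∷ (p *P q))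
0∷-*P p q = +P-cong (scale-0 q) ≋-refl

*P-assoc : ∀ p q r → ((p *P q) *P r) ≋ (p *P (q *P r))
*P-assoc []      q r = ≋-refl
*P-assoc (a ∷ p) q r =
  ≋-trans (*P-distribʳ r (scale a q) (0ℚ ∷ (p *P q)))
  (+P-cong (scale-*P a q r) (≋-trans (0∷-*P (p *P q) r) (∷-cong refl (*P-assoc p q r))))

constP-*P : ∀ c p → (constP c *P p) ≋ scale c p
constP-*P c p = ≋-trans (+P-cong (≋-refl {scale c p}) 0∷[]≋) (+P-identityʳ _)

*P-identityˡ : ∀ p → (constP 1ℚ *P p) ≋ p
*P-identityˡ p = ≋-trans (constP-*P 1ℚ p) (scale-1 p)

polyRing : CommutativeRing 0ℓ 0ℓ
polyRing = record
  { Carrier = Poly ; _≈_ = _≋_ ; _+_ = _+P_ ; _*_ = _*P_ ; -_ = negP ; 0# = [] ; 1# = constP 1ℚ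
  ; isCommutativeRing = record
    { isRing = record
      { +-isAbelianGroup = record
        { isGroup = record
          { isMonoid = record
            { isSemigroup = record
              { isMagma = record
                { isEquivalence = record { refl = ≋-refl ; sym = ≋-sym ; trans = ≋-trans }
                ; ∙-cong = +P-cong }
              ; assoc = +P-assoc }
            ; identity = (λ p → ≋-refl) , +P-identityʳ }
          ; inverse = (λ p → ≋-trans (+P-comm (negP p) p) (+P-inverseʳ p)) , +P-inverseʳ
          ; ⁻¹-cong = scale-cong refl }
        ; comm = +P-comm }
      ; *-cong = *P-cong
      ; *-assoc = *P-assoc
      ; *-identity = *P-identityˡ , λ p → ≋-trans (*P-comm p (constP 1ℚ)) (*P-identityˡ p)
      ; distrib = (λ p q r → ≋-trans (*P-comm p (q +P r))
                    (≋-trans (*P-distribʳ p q r) (+P-cong (*P-comm q p) (*P-comm r p))))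
                , *P-distribʳ }
    ; *-comm = *P-comm } }

isZero? : ∀ p → Maybe ([] ≋ p)
isZero? []      = just ≋-refl
isZero? (a ∷ p) with a ≟ℚ 0ℚ | isZero? p
... | yes e | just f = just (≋-sym (≋-trans (∷-cong e (≋-sym f)) 0∷[]≋))
... | _     | _      = nothing

poly-ring : AlmostCommutativeRing 0ℓ 0ℓ
poly-ring = fromCommutativeRing polyRing isZero?

-- Determinants

module ≋-Reasoning = SetoidReasoning (CommutativeRing.setoid polyRing)

Row : ℕ → Set
Row n = Fin n → Poly

-- Characteristic different from two: with it, antisymmetry in two rows implies vanishing when the
-- rows are equal.
double-zero : ∀ p → (p +P p) ≋ [] → p ≋ []
double-zero p e = pw λ k → begin
  coeff p k                     ≡⟨ half (coeff p k) ⟩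
  ½ *ℚ (coeff p k +ℚ coeff p k) ≡⟨ cong (½ *ℚ_) (trans (sym (coeff-+ p p k)) (at e k)) ⟩
  ½ *ℚ 0ℚ                       ≡⟨⟩
  0ℚ                            ∎
  where
  open ≡-Reasoning
  half : ∀ x → x ≡ ½ *ℚ (x +ℚ x)
  half = solve-∀ ℚ-ring

negP-cong : ∀ {p q} → p ≋ q → negP p ≋ negP q
negP-cong = scale-cong refl

altΣ-cong : ∀ {n} {f g : Row n} → (∀ j → f j ≋ g j) → altΣP f ≋ altΣP g
altΣ-cong {zero}  e = ≋-refl
altΣ-cong {suc n} e = +P-cong (e zero) (negP-cong (altΣ-cong λ j → e (suc j)))

altΣ-zero : ∀ {n} {f : Row n} → (∀ j → f j ≋ []) → altΣP f ≋ []
altΣ-zero {zero}  e = ≋-refl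
altΣ-zero {suc n} e = +P-cong (e zero) (negP-cong (altΣ-zero λ j → e (suc j)))

altΣ-+ : ∀ {n} (f g : Row n) → altΣP (λ j → f j +P g j) ≋ (altΣP f +P altΣP g)
altΣ-+ {zero}  f g = ≋-refl
altΣ-+ {suc n} f g =
  ≋-trans (+P-cong (≋-refl {f zero +P g zero}) (negP-cong (altΣ-+ (λ j → f (suc j)) (λ j → g (suc j)))))
          (regroup (f zero) (g zero) (altΣP λ j → f (suc j)) (altΣP λ j → g (suc j)))
  where
  regroup : ∀ a b c d → ((a +P b) +P negP (c +P d)) ≋ ((a +P negP c) +P (b +P negP d))
  regroup = solve-∀ poly-ring

altΣ-*ˡ : ∀ {n} c (f : Row n) → altΣP (λ j → c *P f j) ≋ (c *P altΣP f)
altΣ-*ˡ {zero}  c f = ≋-sym (*P-[] c)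
altΣ-*ˡ {suc n} c f =
  ≋-trans (+P-cong (≋-refl {c *P f zero}) (negP-cong (altΣ-*ˡ c λ j → f (suc j))))
          (factor c (f zero) (altΣP λ j → f (suc j)))
  where
  factor : ∀ c a b → ((c *P a) +P negP (c *P b)) ≋ (c *P (a +P negP b))
  factor = solve-∀ poly-ring

altΣ-neg : ∀ {n} (f : Row n) → altΣP (λ j → negP (f j)) ≋ negP (altΣP f)
altΣ-neg {zero}  f = ≋-refl
altΣ-neg {suc n} f =
  ≋-trans (+P-cong (≋-refl {negP (f zero)}) (negP-cong (altΣ-neg λ j → f (suc j))))
          (≋-sym (scale-distribˡ (- 1ℚ) (f zero) (negP (altΣP λ j → f (suc j)))))

-- The pairs (0 , k) and (k + 1 , 0) select the same two columns, with opposite signs.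
altΣ²-split : ∀ {n} (F : Fin (suc (suc n)) → Fin (suc n) → Poly) →
  altΣP (λ j → altΣP (F j)) ≋
  (altΣP (λ k → F zero k +P negP (F (suc k) zero)) +P altΣP (λ j → altΣP (λ k → F (suc j) (suc k))))
altΣ²-split F = begin
  altΣP (F zero) +P negP (altΣP (λ j → F (suc j) zero +P negP (altΣP (λ k → F (suc j) (suc k)))))
    ≈⟨ +P-cong (≋-refl {altΣP (F zero)}) (negP-cong (≋-trans (altΣ-+ (λ j → F (suc j) zero) (λ j → negP (altΣP (λ k → F (suc j) (suc k)))))
         (+P-cong (≋-refl {altΣP λ j → F (suc j) zero}) (altΣ-neg (λ j → altΣP (λ k → F (suc j) (suc k))))))) ⟩
  altΣP (F zero) +P negP (altΣP (λ j → F (suc j) zero) +P negP inner)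
    ≈⟨ regroup (altΣP (F zero)) (altΣP λ j → F (suc j) zero) inner ⟩
  (altΣP (F zero) +P negP (altΣP (λ j → F (suc j) zero))) +P inner
    ≈⟨ +P-cong (≋-trans (altΣ-+ (F zero) (λ k → negP (F (suc k) zero)))
         (+P-cong (≋-refl {altΣP (F zero)}) (altΣ-neg λ k → F (suc k) zero))) (≋-refl {inner}) ⟨
  altΣP (λ k → F zero k +P negP (F (suc k) zero)) +P inner ∎
  where
  open ≋-Reasoning
  inner = altΣP (λ j → altΣP (λ k → F (suc j) (suc k)))
  regroup : ∀ a b c → (a +P negP (b +P negP c)) ≋ ((a +P negP b) +P c)
  regroup = solve-∀ poly-ring

ColumnFunction : ℕ → ℕ → Set
ColumnFunction m n = (Fin m → Fin n) → Poly

Congruent : ∀ {m n} → ColumnFunction m n → Set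
Congruent D = ∀ {s t} → (∀ c → s c ≡ t c) → D s ≋ D t

-- Laplace expansion along the first two rows u and v; D is the complementary minor
-- as a function of the remaining columns.
expand₂ : ∀ {n} → Row (suc (suc n)) → Row (suc (suc n)) → ColumnFunction n (suc (suc n)) → Poly
expand₂ u v D = altΣP λ j → u j *P altΣP λ k → v (punchIn j k) *P D (λ c → punchIn j (punchIn k c))

-- What remains of `expand₂` once the terms that take column 0 from `u` or from `v` are split off.
expand₂-inner : ∀ {n} (u v : Row (suc (suc n))) (D : ColumnFunction n (suc (suc n))) → Poly
expand₂-inner u v D = altΣP λ j → altΣP λ k →
  u (suc j) *P (v (suc (punchIn j k)) *P D (λ c → punchIn (suc j) (punchIn (suc k) c)))

expand₂-split : ∀ {n} (u v : Row (suc (suc n))) (D : ColumnFunction n (suc (suc n))) →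
  expand₂ u v D ≋
  (altΣP (λ k → (u zero *P (v (suc k) *P D (λ c → suc (punchIn k c))))
            +P negP (u (suc k) *P (v zero *P D (λ c → suc (punchIn k c)))))
   +P expand₂-inner u v D)
expand₂-split u v D =
  ≋-trans (altΣ-cong λ j → ≋-sym (altΣ-*ˡ (u j) (λ k → v (punchIn j k) *P D (λ c → punchIn j (punchIn k c)))))
          (altΣ²-split (λ j k → u j *P (v (punchIn j k) *P D (λ c → punchIn j (punchIn k c)))))

-- Neither row uses column 0 here, so every complementary minor contains it. Building it in with
-- `lift 1` leaves the same kind of expansion on one column fewer.
expand₂-inner-lift : ∀ {n} (u v : Row (suc (suc (suc n)))) {D : ColumnFunction (suc n) (suc (suc (suc n)))} →
  Congruent D →
  expand₂-inner u v D ≋ expand₂ (λ j → u (suc j)) (λ j → v (suc j)) (λ s → D (lift 1 s))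
expand₂-inner-lift u v {D} D-cong =
  altΣ-cong λ j → ≋-trans
    (altΣ-cong λ k → *P-congʳ (u (suc j)) (*P-congʳ (v (suc (punchIn j k)))
      (D-cong {λ c → punchIn (suc j) (punchIn (suc k) c)} {lift 1 (λ c → punchIn j (punchIn k c))}
              λ { zero → refl ; (suc c) → refl })))
    (altΣ-*ˡ (u (suc j)) (λ k → v (suc (punchIn j k)) *P D (lift 1 (λ c → punchIn j (punchIn k c)))))

lift-cong : ∀ {m n} {s t : Fin m → Fin n} → (∀ c → s c ≡ t c) → ∀ c → lift 1 s c ≡ lift 1 t c
lift-cong e zero    = refl
lift-cong e (suc c) = cong suc (e c)

-- Induction on the number of columns: terms involving column 0 cancel in pairs, and the others form
-- a smaller expansion.
expand₂-antisym : ∀ {n} (u v : Row (suc (suc n))) {D : ColumnFunction n (suc (suc n))} →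
  Congruent D → (expand₂ u v D +P expand₂ v u D) ≋ []
expand₂-antisym {n} u v {D} D-cong = begin
  expand₂ u v D +P expand₂ v u D
    ≈⟨ +P-cong (expand₂-split u v D) (expand₂-split v u D) ⟩
  (border u v +P expand₂-inner u v D) +P (border v u +P expand₂-inner v u D)
    ≈⟨ +P-interchange (border u v) (expand₂-inner u v D) (border v u) (expand₂-inner v u D) ⟩
  (border u v +P border v u) +P (expand₂-inner u v D +P expand₂-inner v u D)
    ≈⟨ +P-cong (≋-trans (≋-sym (altΣ-+ (borderTerm u v) (borderTerm v u)))
                        (altΣ-zero λ k → cancel (u zero) (u (suc k)) (v zero) (v (suc k)) (D (λ c → suc (punchIn k c)))))
               (inner n u v D-cong) ⟩
  [] ∎
  where
  open ≋-Reasoning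
  borderTerm : Row (suc (suc n)) → Row (suc (suc n)) → Row (suc n)
  borderTerm u v k = (u zero *P (v (suc k) *P D (λ c → suc (punchIn k c))))
            +P negP (u (suc k) *P (v zero *P D (λ c → suc (punchIn k c))))
  border : Row (suc (suc n)) → Row (suc (suc n)) → Poly
  border u v = altΣP (borderTerm u v)
  cancel : ∀ a b c d e → (((a *P (d *P e)) +P negP (b *P (c *P e)))
                       +P ((c *P (b *P e)) +P negP (d *P (a *P e)))) ≋ []
  cancel = solve-∀ poly-ring
  inner : ∀ n (u v : Row (suc (suc n))) {D : ColumnFunction n (suc (suc n))} → Congruent D →
    (expand₂-inner u v D +P expand₂-inner v u D) ≋ []
  -- With two columns in all, no pair of columns avoids column 0, and both sums are empty.
  inner zero    u v D-cong = ≋-refl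
  inner (suc n) u v {D} D-cong =
    ≋-trans (+P-cong (expand₂-inner-lift u v D-cong) (expand₂-inner-lift v u D-cong))
            (expand₂-antisym (λ j → u (suc j)) (λ j → v (suc j)) {λ s → D (lift 1 s)} (λ e → D-cong (lift-cong e)))

expand₂-alt : ∀ {n} (u : Row (suc (suc n))) {D : ColumnFunction n (suc (suc n))} →
  Congruent D → expand₂ u u D ≋ []
expand₂-alt u {D} D-cong = double-zero (expand₂ u u D) (expand₂-antisym u u D-cong)

-- Moves `v` to the top, where expanding along it exposes a smaller determinant that still contains
-- the repeated row, ready for induction.
expand₂-flip : ∀ {n} (u v : Row (suc (suc n))) {D : ColumnFunction n (suc (suc n))} →
  Congruent D → expand₂ v u D ≋ [] → expand₂ u v D ≋ []
expand₂-flip u v {D} D-cong e = begin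
  expand₂ u v D                  ≈⟨ +P-identityʳ (expand₂ u v D) ⟨
  expand₂ u v D +P []            ≈⟨ +P-cong (≋-refl {expand₂ u v D}) e ⟨
  expand₂ u v D +P expand₂ v u D ≈⟨ expand₂-antisym u v D-cong ⟩
  []                             ∎
  where open ≋-Reasoning

PMat : ℕ → ℕ → Set
PMat m n = Fin m → Fin n → Poly

det-cong : ∀ {n} {M N : PMat n n} → (∀ i j → M i j ≋ N i j) → det M ≋ det N
det-cong {zero}  e = ≋-refl
det-cong {suc n} e = altΣ-cong λ j → *P-cong (e zero j) (det-cong λ r c → e (suc r) (punchIn j c))

del : ∀ {m n} → PMat m (suc n) → Fin (suc n) → PMat m n
del M j r c = M r (punchIn j c)

below : ∀ {m n} → PMat (suc m) n → PMat m n
below M r = M (suc r)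

cols : ∀ {m n k} → PMat m n → (Fin k → Fin n) → PMat m k
cols M s r c = M r (s c)

≡⇒≋ : ∀ {p q} → p ≡ q → p ≋ q
≡⇒≋ refl = ≋-refl

det-cols-cong : ∀ {m n} (M : PMat m n) → Congruent (λ s → det (cols M s))
det-cols-cong M e = det-cong λ r c → ≡⇒≋ (cong (M r) (e c))

-- The sum is the Laplace expansion of the square matrix obtained by putting row `k` of `M` on top
-- of `M`, which has two equal rows.
det-repeated : ∀ {n} (M : PMat n (suc n)) k → altΣP (λ j → M k j *P det (del M j)) ≋ []
det-repeated {suc n} M zero    = expand₂-alt (M zero) (det-cols-cong (below M))
det-repeated {suc n} M (suc k) = expand₂-flip (M (suc k)) (M zero) (det-cols-cong (below M))
  (altΣ-zero λ j → ≋-trans (*P-congʳ (M zero j) (det-repeated (del (below M) j) k)) (*P-[] (M zero j)))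

-- The derivative of det (M + t · 1vᵀ) at t = 0: the sum over all rows i of the
-- determinant of M with row i replaced by v.
∂det : ∀ {n} → PMat n n → Row n → Poly
∂det {zero}  M v = []
∂det {suc n} M v = altΣP λ j →
  (v j *P det (del (below M) j)) +P (M zero j *P ∂det (del (below M) j) (λ c → v (punchIn j c)))

∂det-cong : ∀ {n} {M N : PMat n n} {u v : Row n} → (∀ i j → M i j ≋ N i j) → (∀ j → u j ≋ v j) →
  ∂det M u ≋ ∂det N v
∂det-cong {zero}  e f = ≋-refl
∂det-cong {suc n} e f = altΣ-cong λ j →
  +P-cong (*P-cong (f j) (det-cong λ r c → e (suc r) (punchIn j c)))
          (*P-cong (e zero j) (∂det-cong (λ r c → e (suc r) (punchIn j c)) (λ c → f (punchIn j c))))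

∂det-+ : ∀ {n} (M : PMat n n) (u v : Row n) → ∂det M (λ j → u j +P v j) ≋ (∂det M u +P ∂det M v)
∂det-+ {zero}  M u v = ≋-refl
∂det-+ {suc n} M u v = ≋-trans
  (altΣ-cong λ j → ≋-trans
    (+P-cong (≋-refl {(u j +P v j) *P det (del (below M) j)})
             (*P-congʳ (M zero j) (∂det-+ (del (below M) j) (λ c → u (punchIn j c)) (λ c → v (punchIn j c)))))
    (regroup (u j) (v j) (det (del (below M) j)) (M zero j) (∂ u j) (∂ v j)))
  (altΣ-+ (λ j → (u j *P det (del (below M) j)) +P (M zero j *P ∂ u j))
          (λ j → (v j *P det (del (below M) j)) +P (M zero j *P ∂ v j)))
  where
  ∂ : Row (suc n) → Row (suc n)
  ∂ w j = ∂det (del (below M) j) (λ c → w (punchIn j c))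
  regroup : ∀ a b d m x y → (((a +P b) *P d) +P (m *P (x +P y))) ≋ (((a *P d) +P (m *P x)) +P ((b *P d) +P (m *P y)))
  regroup = solve-∀ poly-ring

∂det-* : ∀ {n} (M : PMat n n) a (v : Row n) → ∂det M (λ j → a *P v j) ≋ (a *P ∂det M v)
∂det-* {zero}  M a v = ≋-sym (*P-[] a)
∂det-* {suc n} M a v = ≋-trans
  (altΣ-cong λ j → ≋-trans
    (+P-cong (≋-refl {(a *P v j) *P det (del (below M) j)})
             (*P-congʳ (M zero j) (∂det-* (del (below M) j) a (λ c → v (punchIn j c)))))
    (regroup a (v j) (det (del (below M) j)) (M zero j) (∂ j)))
  (altΣ-*ˡ a (λ j → (v j *P det (del (below M) j)) +P (M zero j *P ∂ j)))
  where
  ∂ : Row (suc n)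
  ∂ j = ∂det (del (below M) j) (λ c → v (punchIn j c))
  regroup : ∀ a b d m x → (((a *P b) *P d) +P (m *P (a *P x))) ≋ (a *P ((b *P d) +P (m *P x)))
  regroup = solve-∀ poly-ring

-- The sum puts `v` on top of `M` and replaces one further row by `v`, so each determinant in it has
-- two equal rows.
∂det-repeated : ∀ {n} (M : PMat n (suc n)) (v : Row (suc n)) →
  altΣP (λ j → v j *P ∂det (del M j) (λ c → v (punchIn j c))) ≋ []
∂det-repeated {zero}  M v = altΣ-zero λ j → *P-[] (v j)
∂det-repeated {suc n} M v = begin
  altΣP (λ j → v j *P altΣP (λ k → det-part j k +P ∂-part j k))
    ≈⟨ altΣ-cong (λ j → ≋-trans (*P-congʳ (v j) (altΣ-+ (det-part j) (∂-part j)))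
                                (distrib (v j) (altΣP (det-part j)) (altΣP (∂-part j)))) ⟩
  altΣP (λ j → (v j *P altΣP (det-part j)) +P (v j *P altΣP (∂-part j)))
    ≈⟨ altΣ-+ (λ j → v j *P altΣP (det-part j)) (λ j → v j *P altΣP (∂-part j)) ⟩
  expand₂ v v (λ s → det (cols (below M) s)) +P expand₂ v (M zero) ∂-cols
    ≈⟨ +P-cong (expand₂-alt v (det-cols-cong (below M)))
               (expand₂-flip v (M zero) ∂-cols-cong (altΣ-zero λ j →
                 ≋-trans (*P-congʳ (M zero j) (∂det-repeated (del (below M) j) (λ c → v (punchIn j c))))
                         (*P-[] (M zero j)))) ⟩
  [] ∎
  where
  open ≋-Reasoning
  -- In `det-part` the further row replaced by `v` is the first row of `M`; in `∂-part` it is a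
  -- later one.
  det-part ∂-part : Fin (suc (suc n)) → Fin (suc n) → Poly
  det-part j k = v (punchIn j k) *P det (del (below (del M j)) k)
  ∂-part j k = M zero (punchIn j k) *P ∂det (del (below (del M j)) k) (λ c → v (punchIn j (punchIn k c)))
  ∂-cols : ColumnFunction n (suc (suc n))
  ∂-cols s = ∂det (cols (below M) s) (λ c → v (s c))
  ∂-cols-cong : Congruent ∂-cols
  ∂-cols-cong e = ∂det-cong (λ r c → ≡⇒≋ (cong (M (suc r)) (e c))) (λ c → ≡⇒≋ (cong v (e c)))
  distrib : ∀ a b c → (a *P (b +P c)) ≋ ((a *P b) +P (a *P c))
  distrib = solve-∀ poly-ring

-- The determinant is multilinear in the rows, and terms with `v` in two rows vanish, so the
-- first-order expansion is exact.
det-rank-one-update : ∀ {n} (M : PMat n n) (v : Row n) →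
  det (λ i j → M i j +P v j) ≋ (det M +P ∂det M v)
det-rank-one-update {zero}  M v = ≋-sym (+P-identityʳ _)
det-rank-one-update {suc n} M v = begin
  altΣP (λ j → (M zero j +P v j) *P det (λ r c → minor j r c +P v (punchIn j c)))
    ≈⟨ altΣ-cong (λ j → ≋-trans
         (*P-congʳ (M zero j +P v j) (det-rank-one-update (minor j) (λ c → v (punchIn j c))))
         (regroup (M zero j) (v j) (det (minor j)) (∂ j))) ⟩
  altΣP (λ j → ((M zero j *P det (minor j)) +P ((v j *P det (minor j)) +P (M zero j *P ∂ j))) +P (v j *P ∂ j))
    ≈⟨ altΣ-+ (λ j → (M zero j *P det (minor j)) +P ((v j *P det (minor j)) +P (M zero j *P ∂ j))) (λ j → v j *P ∂ j) ⟩
  altΣP (λ j → (M zero j *P det (minor j)) +P ((v j *P det (minor j)) +P (M zero j *P ∂ j)))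
    +P altΣP (λ j → v j *P ∂ j)
    ≈⟨ +P-cong (altΣ-+ (λ j → M zero j *P det (minor j)) (λ j → (v j *P det (minor j)) +P (M zero j *P ∂ j))) (∂det-repeated (below M) v) ⟩
  (det M +P ∂det M v) +P []
    ≈⟨ +P-identityʳ _ ⟩
  det M +P ∂det M v ∎
  where
  open ≋-Reasoning
  minor : Fin (suc n) → PMat n n
  minor = del (below M)
  ∂ : Row (suc n)
  ∂ j = ∂det (minor j) (λ c → v (punchIn j c))
  regroup : ∀ m a d x → ((m +P a) *P (d +P x)) ≋ (((m *P d) +P ((a *P d) +P (m *P x))) +P (a *P x))
  regroup = solve-∀ poly-ring

-- Putting row `k` in place of another row creates a repetition; only putting it in its own place
-- contributes. With linearity in the row this is Cramer's rule for the right-hand side `det M`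
-- times e.
∂det-row : ∀ {n} (M : PMat n n) k → ∂det M (M k) ≋ det M
∂det-row {suc n} M k = ≋-trans
  (altΣ-+ (λ j → M k j *P det (del (below M) j)) (λ j → M zero j *P ∂ k j)) (parts k)
  where
  ∂ : Fin (suc n) → Row (suc n)
  ∂ k j = ∂det (del (below M) j) (λ c → M k (punchIn j c))
  parts : ∀ k → (altΣP (λ j → M k j *P det (del (below M) j)) +P altΣP (λ j → M zero j *P ∂ k j)) ≋ det M
  parts zero    = ≋-trans (+P-cong (≋-refl {det M}) (∂det-repeated (below M) (M zero))) (+P-identityʳ (det M))
  parts (suc k) = +P-cong (det-repeated (below M) k)
    (altΣ-cong {f = λ j → M zero j *P ∂ (suc k) j} {g = λ j → M zero j *P det (del (below M) j)}
      λ j → *P-congʳ (M zero j) (∂det-row (del (below M) j) k))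

sgn : ℕ → Poly
sgn zero    = constP 1ℚ
sgn (suc n) = negP (sgn n)

sgn² : ∀ n → (sgn n *P sgn n) ≋ constP 1ℚ
sgn² zero    = *P-identityˡ _
sgn² (suc n) = ≋-trans (neg-neg (sgn n)) (sgn² n)
  where
  neg-neg : ∀ a → (negP a *P negP a) ≋ (a *P a)
  neg-neg = solve-∀ poly-ring

det-neg : ∀ {n} (M : PMat n n) → det (λ i j → negP (M i j)) ≋ (sgn n *P det M)
det-neg {zero}  M = ≋-sym (*P-identityˡ _)
det-neg {suc n} M = ≋-trans
  (altΣ-cong λ j → ≋-trans (*P-congʳ (negP (M zero j)) (det-neg (del (below M) j)))
                           (regroup (M zero j) (sgn n) (det (del (below M) j))))
  (altΣ-*ˡ (sgn (suc n)) (λ j → M zero j *P det (del (below M) j)))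
  where
  regroup : ∀ m s d → (negP m *P (s *P d)) ≋ (negP s *P (m *P d))
  regroup = solve-∀ poly-ring

-- Endomorphisms of the polynomial ring and linear functionals on rows

record IsEndomorphism (h : Poly → Poly) : Set where
  field
    +-homo : ∀ p q → h (p +P q) ≋ (h p +P h q)
    *-homo : ∀ p q → h (p *P q) ≋ (h p *P h q)
    neg-homo : ∀ p → h (negP p) ≋ negP (h p)
    0-homo : h [] ≋ []
    1-homo : h (constP 1ℚ) ≋ constP 1ℚ

module _ {h : Poly → Poly} (h-endo : IsEndomorphism h) where
  open IsEndomorphism h-endo

  altΣ-homo : ∀ {n} (f : Row n) → h (altΣP f) ≋ altΣP (λ j → h (f j))
  altΣ-homo {zero}  f = 0-homo
  altΣ-homo {suc n} f = ≋-trans (+-homo _ _) (+P-cong ≋-refl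
    (≋-trans (neg-homo _) (negP-cong (altΣ-homo λ j → f (suc j)))))

  det-homo : ∀ {n} (M : PMat n n) → h (det M) ≋ det (λ i j → h (M i j))
  det-homo {zero}  M = 1-homo
  det-homo {suc n} M = ≋-trans (altΣ-homo (λ j → M zero j *P det (del (below M) j)))
    (altΣ-cong λ j → ≋-trans (*-homo _ _) (*P-congʳ (h (M zero j)) (det-homo (del (below M) j))))

unit : ∀ {n} → Fin n → Row n
unit zero    zero    = constP 1ℚ
unit zero    (suc k) = []
unit (suc j) zero    = []
unit (suc j) (suc k) = unit j k

record IsLinear {n} (F : Row n → Poly) : Set where
  field
    F-cong : ∀ {u v} → (∀ j → u j ≋ v j) → F u ≋ F v
    F-+    : ∀ u v → F (λ j → u j +P v j) ≋ (F u +P F v)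
    F-*    : ∀ a v → F (λ j → a *P v j) ≋ (a *P F v)

infixr 5 _◂_
_◂_ : ∀ {n} → Poly → Row n → Row (suc n)
(a ◂ v) zero    = a
(a ◂ v) (suc j) = v j

linear-expansion : ∀ {n} {F : Row n → Poly} → IsLinear F → ∀ v → F v ≋ ΣP (λ j → v j *P F (unit j))
linear-expansion {zero} {F} F-lin v =
  -- An empty row equals its own multiple by 0, so homogeneity already gives the value 0.
  ≋-trans (F-cong {v = λ j → [] *P v j} (λ ())) (F-* [] v)
  where open IsLinear F-lin
linear-expansion {suc n} {F} F-lin v = begin
  F v
    ≈⟨ F-cong (λ { zero → ≋-sym (≋-trans (+P-identityʳ (v zero *P constP 1ℚ)) (*-identityʳ (v zero)))
                 ; (suc j) → ≋-sym (+P-cong (*P-[] (v zero)) (≋-refl {v (suc j)})) }) ⟩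
  F (λ j → (v zero *P unit zero j) +P ([] ◂ (λ j → v (suc j))) j)
    ≈⟨ F-+ (λ j → v zero *P unit zero j) ([] ◂ (λ j → v (suc j))) ⟩
  F (λ j → v zero *P unit zero j) +P F ([] ◂ (λ j → v (suc j)))
    ≈⟨ +P-cong (F-* (v zero) (unit zero))
         (≋-trans (linear-expansion tail-linear (λ j → v (suc j)))
                  (ΣP-cong λ j → *P-congʳ (v (suc j)) (F-cong λ { zero → ≋-refl ; (suc k) → ≋-refl }))) ⟩
  ΣP (λ j → v j *P F (unit j)) ∎
  where
  open ≋-Reasoning
  open IsLinear F-lin
  open CommutativeRing polyRing using (*-identityʳ)
  ΣP-cong : ∀ {m} {f g : Row m} → (∀ j → f j ≋ g j) → ΣP f ≋ ΣP g
  ΣP-cong {zero}  e = ≋-refl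
  ΣP-cong {suc m} e = +P-cong (e zero) (ΣP-cong λ j → e (suc j))
  tail-linear : IsLinear (λ w → F ([] ◂ w))
  tail-linear = record
    { F-cong = λ e → F-cong λ { zero → ≋-refl ; (suc j) → e j }
    ; F-+ = λ u w → ≋-trans (F-cong λ { zero → ≋-refl ; (suc j) → ≋-refl }) (F-+ ([] ◂ u) ([] ◂ w))
    ; F-* = λ a w → ≋-trans (F-cong λ { zero → ≋-sym (*P-[] a) ; (suc j) → ≋-refl }) (F-* a ([] ◂ w)) }

∂det-linear : ∀ {n} (M : PMat n n) → IsLinear (∂det M)
∂det-linear M = record
  { F-cong = ∂det-cong (λ i j → ≋-refl)
  ; F-+ = ∂det-+ M
  ; F-* = ∂det-* M }

-- Linear algebra over ℚ

ℚ-inverse : ∀ a → a ≢ 0ℚ → ∃[ b ] b *ℚ a ≡ 1ℚ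
ℚ-inverse a a≢0 = (1/ a) {{≢-nonZero a≢0}} , ℚₚ.*-inverseˡ a {{≢-nonZero a≢0}}

*-cancel-zero : ∀ a b → a ≢ 0ℚ → a *ℚ b ≡ 0ℚ → b ≡ 0ℚ
*-cancel-zero a b a≢0 ab≡0 with ℚ-inverse a a≢0
... | c , ca≡1 = begin
  b              ≡⟨ ℚₚ.*-identityˡ b ⟨
  1ℚ *ℚ b        ≡⟨ cong (_*ℚ b) ca≡1 ⟨
  (c *ℚ a) *ℚ b  ≡⟨ ℚₚ.*-assoc c a b ⟩
  c *ℚ (a *ℚ b)  ≡⟨ cong (c *ℚ_) ab≡0 ⟩
  c *ℚ 0ℚ        ≡⟨ ℚₚ.*-zeroʳ c ⟩
  0ℚ             ∎
  where open ≡-Reasoning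

Vecℚ : ℕ → Set
Vecℚ n = Fin n → ℚ

Σ-cong : ∀ {n} {f g : Vecℚ n} → (∀ i → f i ≡ g i) → Σℚ f ≡ Σℚ g
Σ-cong {zero}  e = refl
Σ-cong {suc n} e = cong₂ _+ℚ_ (e zero) (Σ-cong λ i → e (suc i))

Σ-zero : ∀ {n} {f : Vecℚ n} → (∀ i → f i ≡ 0ℚ) → Σℚ f ≡ 0ℚ
Σ-zero {zero}  e = refl
Σ-zero {suc n} e = cong₂ _+ℚ_ (e zero) (Σ-zero λ i → e (suc i))

Σ-+ : ∀ {n} (f g : Vecℚ n) → Σℚ (λ i → f i +ℚ g i) ≡ Σℚ f +ℚ Σℚ g
Σ-+ {zero}  f g = refl
Σ-+ {suc n} f g = trans (cong ((f zero +ℚ g zero) +ℚ_) (Σ-+ (λ i → f (suc i)) (λ i → g (suc i))))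
  (regroup (f zero) (g zero) _ _)
  where
  regroup : ∀ a b c d → (a +ℚ b) +ℚ (c +ℚ d) ≡ (a +ℚ c) +ℚ (b +ℚ d)
  regroup = solve-∀ ℚ-ring

Σ-*ˡ : ∀ {n} c (f : Vecℚ n) → Σℚ (λ i → c *ℚ f i) ≡ c *ℚ Σℚ f
Σ-*ˡ {zero}  c f = sym (ℚₚ.*-zeroʳ c)
Σ-*ˡ {suc n} c f = trans (cong ((c *ℚ f zero) +ℚ_) (Σ-*ˡ c λ i → f (suc i)))
  (sym (ℚₚ.*-distribˡ-+ c (f zero) _))

Σ-*ʳ : ∀ {n} c (f : Vecℚ n) → Σℚ (λ i → f i *ℚ c) ≡ Σℚ f *ℚ c
Σ-*ʳ c f = trans (Σ-cong λ i → ℚₚ.*-comm (f i) c) (trans (Σ-*ˡ c f) (ℚₚ.*-comm c (Σℚ f)))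

Σ-swap : ∀ {m n} (f : Fin m → Fin n → ℚ) → Σℚ (λ i → Σℚ (f i)) ≡ Σℚ (λ j → Σℚ (λ i → f i j))
Σ-swap {zero} {n} f = sym (Σ-zero {n} λ j → refl)
Σ-swap {suc m} f = trans (cong (Σℚ (f zero) +ℚ_) (Σ-swap λ i → f (suc i)))
  (sym (Σ-+ (f zero) (λ j → Σℚ (λ i → f (suc i) j))))

Σ-remove : ∀ {n} (f : Vecℚ (suc n)) i → Σℚ f ≡ f i +ℚ Σℚ (λ j → f (punchIn i j))
Σ-remove         f zero    = refl
Σ-remove {suc n} f (suc i) = trans (cong (f zero +ℚ_) (Σ-remove (λ j → f (suc j)) i))
  (regroup (f zero) (f (suc i)) _)
  where
  regroup : ∀ a b c → a +ℚ (b +ℚ c) ≡ b +ℚ (a +ℚ c)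
  regroup = solve-∀ ℚ-ring

δ-suc : ∀ {n} (i j : Fin n) → δ (suc i) (suc j) ≡ δ i j
δ-suc i j with i ≟ j
... | yes _ = refl
... | no  _ = refl

δ-sym : ∀ {n} (i j : Fin n) → δ i j ≡ δ j i
δ-sym zero    zero    = refl
δ-sym zero    (suc j) = refl
δ-sym (suc i) zero    = refl
δ-sym (suc i) (suc j) = trans (δ-suc i j) (trans (δ-sym i j) (sym (δ-suc j i)))

δ-diag : ∀ {n} (i : Fin n) → δ i i ≡ 1ℚ
δ-diag zero    = refl
δ-diag (suc i) = trans (δ-suc i i) (δ-diag i)

Σ-δ : ∀ {n} (i : Fin n) (f : Vecℚ n) → Σℚ (λ j → δ i j *ℚ f j) ≡ f i
Σ-δ zero    f = trans (cong₂ _+ℚ_ (ℚₚ.*-identityˡ (f zero)) (Σ-zero λ j → ℚₚ.*-zeroˡ (f (suc j))))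
  (ℚₚ.+-identityʳ (f zero))
Σ-δ (suc i) f = trans (cong₂ _+ℚ_ (ℚₚ.*-zeroˡ (f zero)) (trans (Σ-cong λ j → cong (_*ℚ f (suc j)) (δ-suc i j))
  (Σ-δ i λ j → f (suc j)))) (ℚₚ.+-identityˡ (f (suc i)))

-- Fraction-free elimination of the first coordinate.
dependent : ∀ n (vs : Fin (suc n) → Vecℚ n) →
  Σ[ c ∈ Vecℚ (suc n) ] (∃[ i ] c i ≢ 0ℚ) × (∀ k → Σℚ (λ i → c i *ℚ vs i k) ≡ 0ℚ)
dependent zero    vs = (λ _ → 1ℚ) , (zero , λ ()) , λ ()
dependent (suc n) vs with any? (λ i → ¬? (vs i zero ≟ℚ 0ℚ))
... | no all-zero with dependent n (λ j k → vs (suc j) (suc k))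
...   | c , (i , ci≢0) , rel = c′ , (suc i , ci≢0) , rel′
  where
  c′ : Vecℚ (suc (suc n))
  -- When all first coordinates vanish there is one vector more than the induction needs; it gets
  -- weight 0.
  c′ zero    = 0ℚ
  c′ (suc j) = c j
  vanish : ∀ i → vs i zero ≡ 0ℚ
  vanish i = decidable-stable (vs i zero ≟ℚ 0ℚ) (λ ne → all-zero (i , ne))
  rel′ : ∀ k → Σℚ (λ i → c′ i *ℚ vs i k) ≡ 0ℚ
  rel′ zero    = Σ-zero λ i → trans (cong (c′ i *ℚ_) (vanish i)) (ℚₚ.*-zeroʳ (c′ i))
  rel′ (suc k) = cong₂ _+ℚ_ (ℚₚ.*-zeroˡ (vs zero (suc k))) (rel k)
dependent (suc n) vs | yes (p , a≢0)
  with dependent n (λ j k → (vs p zero *ℚ vs (punchIn p j) (suc k)) +ℚ (- (vs (punchIn p j) zero *ℚ vs p (suc k))))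
... | c , (i , ci≢0) , rel = c′ , (punchIn p i , c′≢0) , rel′
  where
  open ≡-Reasoning
  a = vs p zero
  v : Fin (suc n) → Vecℚ (suc n)
  v j = vs (punchIn p j)
  t = Σℚ (λ j → c j *ℚ v j zero)
  c′ : Vecℚ (suc (suc n))
  -- A relation `c` among the eliminated vectors a vⱼ - vⱼ(0) vₚ unfolds to weight a cⱼ on vⱼ and
  -- weight -Σ cⱼ vⱼ(0) on the pivot.
  c′ = insertAt (λ j → a *ℚ c j) p (- t)
  c′≢0 : c′ (punchIn p i) ≢ 0ℚ
  c′≢0 e = ci≢0 (*-cancel-zero a (c i) a≢0 (trans (sym (insertAt-punchIn (λ j → a *ℚ c j) p (- t) i)) e))
  split : ∀ k → Σℚ (λ i → c′ i *ℚ vs i k) ≡ ((- t) *ℚ vs p k) +ℚ Σℚ (λ j → (a *ℚ c j) *ℚ v j k)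
  split k = trans (Σ-remove (λ i → c′ i *ℚ vs i k) p)
    (cong₂ _+ℚ_ (cong (_*ℚ vs p k) (insertAt-lookup (λ j → a *ℚ c j) p (- t)))
                (Σ-cong λ j → cong (_*ℚ v j k) (insertAt-punchIn (λ j → a *ℚ c j) p (- t) j)))
  pull : ∀ a c x → (a *ℚ c) *ℚ x ≡ a *ℚ (c *ℚ x)
  pull = solve-∀ ℚ-ring
  cancel : ∀ t a → ((- t) *ℚ a) +ℚ (a *ℚ t) ≡ 0ℚ
  cancel = solve-∀ ℚ-ring
  regroup : ∀ c a x y w → (c *ℚ ((a *ℚ x) +ℚ (- (y *ℚ w)))) +ℚ ((c *ℚ y) *ℚ w) ≡ (a *ℚ c) *ℚ x
  regroup = solve-∀ ℚ-ring
  rearrange : ∀ t w r → ((- t) *ℚ w) +ℚ (r +ℚ (t *ℚ w)) ≡ r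
  rearrange = solve-∀ ℚ-ring
  rel′ : ∀ k → Σℚ (λ i → c′ i *ℚ vs i k) ≡ 0ℚ
  rel′ zero = begin
    Σℚ (λ i → c′ i *ℚ vs i zero)                           ≡⟨ split zero ⟩
    ((- t) *ℚ a) +ℚ Σℚ (λ j → (a *ℚ c j) *ℚ v j zero)      ≡⟨ cong (((- t) *ℚ a) +ℚ_)
                                                              (trans (Σ-cong λ j → pull a (c j) (v j zero)) (Σ-*ˡ a (λ j → c j *ℚ v j zero))) ⟩
    ((- t) *ℚ a) +ℚ (a *ℚ t)                               ≡⟨ cancel t a ⟩
    0ℚ                                                     ∎
  rel′ (suc k) = begin
    Σℚ (λ i → c′ i *ℚ vs i (suc k))
      ≡⟨ split (suc k) ⟩
    ((- t) *ℚ w) +ℚ Σℚ (λ j → (a *ℚ c j) *ℚ v j (suc k))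
      ≡⟨ cong (((- t) *ℚ w) +ℚ_) (trans (Σ-cong λ j → sym (regroup (c j) a (v j (suc k)) (v j zero) w)) (trans (Σ-+ eliminated (λ j → (c j *ℚ v j zero) *ℚ w))
           (cong₂ _+ℚ_ (rel k) (Σ-*ʳ w (λ j → c j *ℚ v j zero))))) ⟩
    ((- t) *ℚ w) +ℚ (0ℚ +ℚ (t *ℚ w))
      ≡⟨ rearrange t w 0ℚ ⟩
    0ℚ ∎
    where
    w = vs p (suc k)
    eliminated : Vecℚ (suc n)
    eliminated j = c j *ℚ ((a *ℚ v j (suc k)) +ℚ (- (v j zero *ℚ w)))

-- Inner products and the action of polynomials in a matrix

infixr 7 _·_
_·_ : ∀ {m n} → Mat m n → Vecℚ n → Vecℚ m
(A · v) i = Σℚ (λ j → A i j *ℚ v j)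

⟨_,_⟩ : ∀ {n} → Vecℚ n → Vecℚ n → ℚ
⟨ u , v ⟩ = Σℚ (λ i → u i *ℚ v i)

⟨⟩-cong : ∀ {n} {u u′ v v′ : Vecℚ n} → (∀ i → u i ≡ u′ i) → (∀ i → v i ≡ v′ i) → ⟨ u , v ⟩ ≡ ⟨ u′ , v′ ⟩
⟨⟩-cong e f = Σ-cong λ i → cong₂ _*ℚ_ (e i) (f i)

⟨⟩-comm : ∀ {n} (u v : Vecℚ n) → ⟨ u , v ⟩ ≡ ⟨ v , u ⟩
⟨⟩-comm u v = Σ-cong λ i → ℚₚ.*-comm (u i) (v i)

⟨⟩-+ʳ : ∀ {n} (u v w : Vecℚ n) → ⟨ u , (λ i → v i +ℚ w i) ⟩ ≡ ⟨ u , v ⟩ +ℚ ⟨ u , w ⟩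
⟨⟩-+ʳ u v w = trans (Σ-cong λ i → ℚₚ.*-distribˡ-+ (u i) (v i) (w i)) (Σ-+ (λ i → u i *ℚ v i) (λ i → u i *ℚ w i))

⟨⟩-*ʳ : ∀ {n} (u : Vecℚ n) c v → ⟨ u , (λ i → c *ℚ v i) ⟩ ≡ c *ℚ ⟨ u , v ⟩
⟨⟩-*ʳ u c v = trans (Σ-cong λ i → regroup (u i) c (v i)) (Σ-*ˡ c (λ i → u i *ℚ v i))
  where
  regroup : ∀ x c y → x *ℚ (c *ℚ y) ≡ c *ℚ (x *ℚ y)
  regroup = solve-∀ ℚ-ring

Symmetric : ∀ {n} → Mat n n → Set
Symmetric A = ∀ i j → A i j ≡ A j i

⟨⟩-adjoint : ∀ {m n} (A : Mat m n) u v → ⟨ u , A · v ⟩ ≡ ⟨ (A ᵀ) · u , v ⟩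
⟨⟩-adjoint A u v = begin
  Σℚ (λ i → u i *ℚ Σℚ (λ j → A i j *ℚ v j))     ≡⟨ Σ-cong (λ i → sym (Σ-*ˡ (u i) (λ j → A i j *ℚ v j))) ⟩
  Σℚ (λ i → Σℚ (λ j → u i *ℚ (A i j *ℚ v j)))   ≡⟨ Σ-swap (λ i j → u i *ℚ (A i j *ℚ v j)) ⟩
  Σℚ (λ j → Σℚ (λ i → u i *ℚ (A i j *ℚ v j)))   ≡⟨ Σ-cong (λ j → trans (Σ-cong λ i → regroup (u i) (A i j) (v j))
                                                       (Σ-*ʳ (v j) (λ i → A i j *ℚ u i))) ⟩
  Σℚ (λ j → Σℚ (λ i → A i j *ℚ u i) *ℚ v j)     ∎
  where
  open ≡-Reasoning
  regroup : ∀ x a y → x *ℚ (a *ℚ y) ≡ (a *ℚ x) *ℚ y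
  regroup = solve-∀ ℚ-ring

module Action {n} (A : Mat n n) where

  -- p(A) v, by Horner's rule
  act : Poly → Vecℚ n → Vecℚ n
  act []      v i = 0ℚ
  act (a ∷ p) v i = (a *ℚ v i) +ℚ (A · act p v) i

  act-cong : ∀ p {u v} → (∀ i → u i ≡ v i) → ∀ i → act p u i ≡ act p v i
  act-cong []      e i = refl
  act-cong (a ∷ p) e i = cong₂ _+ℚ_ (cong (a *ℚ_) (e i)) (Σ-cong λ j → cong (A i j *ℚ_) (act-cong p e j))

  act-+P : ∀ p q v i → act (p +P q) v i ≡ act p v i +ℚ act q v i
  act-+P []      q       v i = sym (ℚₚ.+-identityˡ _)
  act-+P (a ∷ p) []      v i = sym (ℚₚ.+-identityʳ _)
  act-+P (a ∷ p) (b ∷ q) v i = trans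
    (cong (((a +ℚ b) *ℚ v i) +ℚ_) (trans (Σ-cong λ j → trans (cong (A i j *ℚ_) (act-+P p q v j))
       (ℚₚ.*-distribˡ-+ (A i j) (act p v j) (act q v j))) (Σ-+ (λ j → A i j *ℚ act p v j) (λ j → A i j *ℚ act q v j))))
    (regroup a b (v i) ((A · act p v) i) ((A · act q v) i))
    where
    regroup : ∀ a b x c d → ((a +ℚ b) *ℚ x) +ℚ (c +ℚ d) ≡ ((a *ℚ x) +ℚ c) +ℚ ((b *ℚ x) +ℚ d)
    regroup = solve-∀ ℚ-ring

  act-scale : ∀ c p v i → act (scale c p) v i ≡ c *ℚ act p v i
  act-scale c []      v i = sym (ℚₚ.*-zeroʳ c)
  act-scale c (a ∷ p) v i = trans
    (cong (((c *ℚ a) *ℚ v i) +ℚ_) (trans (Σ-cong λ j → trans (cong (A i j *ℚ_) (act-scale c p v j))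
       (regroup₁ (A i j) c (act p v j))) (Σ-*ˡ c (λ j → A i j *ℚ act p v j))))
    (regroup₂ c a (v i) ((A · act p v) i))
    where
    regroup₁ : ∀ x c y → x *ℚ (c *ℚ y) ≡ c *ℚ (x *ℚ y)
    regroup₁ = solve-∀ ℚ-ring
    regroup₂ : ∀ c a x y → ((c *ℚ a) *ℚ x) +ℚ (c *ℚ y) ≡ c *ℚ ((a *ℚ x) +ℚ y)
    regroup₂ = solve-∀ ℚ-ring

  act-*P : ∀ p q v i → act (p *P q) v i ≡ act p (act q v) i
  act-*P []      q v i = refl
  act-*P (a ∷ p) q v i = trans (act-+P (scale a q) (0ℚ ∷ (p *P q)) v i)
    (cong₂ _+ℚ_ (act-scale a q v i)
      (trans (cong₂ _+ℚ_ (ℚₚ.*-zeroˡ (v i)) (Σ-cong λ j → cong (A i j *ℚ_) (act-*P p q v j)))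
             (ℚₚ.+-identityˡ _)))

  act-zero : ∀ p → p ≋ [] → ∀ v i → act p v i ≡ 0ℚ
  act-zero []      e v i = refl
  act-zero (a ∷ p) e v i = cong₂ _+ℚ_ (trans (cong (_*ℚ v i) (at e zero)) (ℚₚ.*-zeroˡ (v i)))
    (Σ-zero λ j → trans (cong (A i j *ℚ_) (act-zero p (pw λ k → at e (suc k)) v j)) (ℚₚ.*-zeroʳ (A i j)))

  act-≋ : ∀ {p q} → p ≋ q → ∀ v i → act p v i ≡ act q v i
  act-≋ {[]}    {q}     e v i = sym (act-zero q (≋-sym e) v i)
  act-≋ {a ∷ p} {[]}    e v i = act-zero (a ∷ p) e v i
  act-≋ {a ∷ p} {b ∷ q} e v i = cong₂ _+ℚ_ (cong (_*ℚ v i) (at e zero))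
    (Σ-cong λ j → cong (A i j *ℚ_) (act-≋ (tail-≋ e) v j))

  act-comm : ∀ p q v i → act p (act q v) i ≡ act q (act p v) i
  act-comm p q v i = trans (sym (act-*P p q v i)) (trans (act-≋ (*P-comm p q) v i) (act-*P q p v i))

  act-0 : ∀ p i → act p (λ _ → 0ℚ) i ≡ 0ℚ
  act-0 p i = trans (act-comm p [] (λ _ → 0ℚ) i) refl

  act-const : ∀ c v i → act (constP c) v i ≡ c *ℚ v i
  act-const c v i = trans (cong ((c *ℚ v i) +ℚ_) (Σ-zero λ j → ℚₚ.*-zeroʳ (A i j))) (ℚₚ.+-identityʳ _)

  act-X : ∀ p v i → act (0ℚ ∷ p) v i ≡ (A · act p v) i
  act-X p v i = trans (cong (_+ℚ (A · act p v) i) (ℚₚ.*-zeroˡ (v i))) (ℚₚ.+-identityˡ _)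

  act-adjoint : Symmetric A → ∀ p u v → ⟨ act p u , v ⟩ ≡ ⟨ u , act p v ⟩
  act-adjoint A-sym []      u v = trans (Σ-zero λ i → ℚₚ.*-zeroˡ (v i)) (sym (Σ-zero λ i → ℚₚ.*-zeroʳ (u i)))
  act-adjoint A-sym (a ∷ p) u v = begin
    ⟨ act (a ∷ p) u , v ⟩
      ≡⟨ ⟨⟩-comm (act (a ∷ p) u) v ⟩
    ⟨ v , act (a ∷ p) u ⟩
      ≡⟨ trans (⟨⟩-+ʳ v _ _) (cong₂ _+ℚ_ (⟨⟩-*ʳ v a u) (⟨⟩-adjoint A v (act p u))) ⟩
    (a *ℚ ⟨ v , u ⟩) +ℚ ⟨ (A ᵀ) · v , act p u ⟩
      ≡⟨ cong₂ _+ℚ_ (cong (a *ℚ_) (⟨⟩-comm v u)) (trans (⟨⟩-comm ((A ᵀ) · v) (act p u)) (act-adjoint A-sym p u ((A ᵀ) · v))) ⟩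
    (a *ℚ ⟨ u , v ⟩) +ℚ ⟨ u , act p ((A ᵀ) · v) ⟩
      ≡⟨ cong ((a *ℚ ⟨ u , v ⟩) +ℚ_) (⟨⟩-cong {u = u} (λ i → refl) (λ i → trans (act-cong p Aᵀ i) (A-act i))) ⟩
    (a *ℚ ⟨ u , v ⟩) +ℚ ⟨ u , A · act p v ⟩
      ≡⟨ cong (_+ℚ ⟨ u , A · act p v ⟩) (⟨⟩-*ʳ u a v) ⟨
    ⟨ u , (λ i → a *ℚ v i) ⟩ +ℚ ⟨ u , A · act p v ⟩
      ≡⟨ ⟨⟩-+ʳ u _ _ ⟨
    ⟨ u , act (a ∷ p) v ⟩ ∎
    where
    open ≡-Reasoning
    -- Multiplication by A is the action of the polynomial x, so it commutes with `act p`; symmetry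
    -- identifies it with multiplication by the transpose.
    Aᵀ : ∀ i → ((A ᵀ) · v) i ≡ act (0ℚ ∷ constP 1ℚ) v i
    Aᵀ i = sym (trans (act-X (constP 1ℚ) v i) (Σ-cong λ j → cong₂ _*ℚ_ (A-sym i j)
      (trans (act-const 1ℚ v j) (ℚₚ.*-identityˡ (v j)))))
    A-act : ∀ i → act p (act (0ℚ ∷ constP 1ℚ) v) i ≡ (A · act p v) i
    A-act i = trans (act-comm p (0ℚ ∷ constP 1ℚ) v i) (trans (act-X (constP 1ℚ) (act p v) i)
      (Σ-cong λ j → cong (A i j *ℚ_) (trans (act-const 1ℚ (act p v) j) (ℚₚ.*-identityˡ (act p v j)))))

-- p(−x)
reflect : Poly → Poly
reflect []      = []
reflect (a ∷ p) = a ∷ negP (reflect p)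

-- For S the diagonal matrix of `s`, moving S past each factor A costs a sign: S p(A) = p(-A) S.
sign-act : ∀ {n} (A : Mat n n) (s : Vecℚ n) → (∀ i j → s i *ℚ A i j ≡ - (A i j *ℚ s j)) →
  ∀ p v i → s i *ℚ Action.act A p v i ≡ Action.act A (reflect p) (λ j → s j *ℚ v j) i
sign-act A s anti []      v i = ℚₚ.*-zeroʳ (s i)
sign-act A s anti (a ∷ p) v i = begin
  s i *ℚ ((a *ℚ v i) +ℚ (A · act p v) i)
    ≡⟨ distrib (s i) a (v i) _ ⟩
  (a *ℚ (s i *ℚ v i)) +ℚ (s i *ℚ (A · act p v) i)
    ≡⟨ cong ((a *ℚ (s i *ℚ v i)) +ℚ_) (trans (sym (Σ-*ˡ (s i) (λ j → A i j *ℚ act p v j))) (Σ-cong term)) ⟩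
  act (reflect (a ∷ p)) (λ j → s j *ℚ v j) i ∎
  where
  open ≡-Reasoning
  open Action A
  distrib : ∀ s a x y → s *ℚ ((a *ℚ x) +ℚ y) ≡ (a *ℚ (s *ℚ x)) +ℚ (s *ℚ y)
  distrib = solve-∀ ℚ-ring
  regroup : ∀ a t x → (- (a *ℚ t)) *ℚ x ≡ a *ℚ ((- 1ℚ) *ℚ (t *ℚ x))
  regroup = solve-∀ ℚ-ring
  term : ∀ j → s i *ℚ (A i j *ℚ act p v j) ≡ A i j *ℚ act (negP (reflect p)) (λ k → s k *ℚ v k) j
  term j = begin
    s i *ℚ (A i j *ℚ act p v j)                    ≡⟨ ℚₚ.*-assoc (s i) (A i j) (act p v j) ⟨
    (s i *ℚ A i j) *ℚ act p v j                    ≡⟨ cong (_*ℚ act p v j) (anti i j) ⟩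
    (- (A i j *ℚ s j)) *ℚ act p v j                ≡⟨ regroup (A i j) (s j) (act p v j) ⟩
    A i j *ℚ ((- 1ℚ) *ℚ (s j *ℚ act p v j))        ≡⟨ cong (λ x → A i j *ℚ ((- 1ℚ) *ℚ x)) (sign-act A s anti p v j) ⟩
    A i j *ℚ ((- 1ℚ) *ℚ act (reflect p) _ j)       ≡⟨ cong (A i j *ℚ_) (act-scale (- 1ℚ) (reflect p) _ j) ⟨
    A i j *ℚ act (negP (reflect p)) _ j            ∎

-- Division and irreducibility

-- A degree bound insensitive to trailing zeros. The zero polynomial satisfies every bound, and only
-- it satisfies the bound 0.
DegLt : Poly → ℕ → Set
DegLt p n = ∀ k → n ≤ k → coeff p k ≡ 0ℚ

DegLt-cong : ∀ {p q n} → p ≋ q → DegLt p n → DegLt q n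
DegLt-cong e d k n≤k = trans (sym (at e k)) (d k n≤k)

DegLt-+ : ∀ p q {n} → DegLt p n → DegLt q n → DegLt (p +P q) n
DegLt-+ p q d e k n≤k = trans (coeff-+ p q k) (cong₂ _+ℚ_ (d k n≤k) (e k n≤k))

DegLt-scale : ∀ c p {n} → DegLt p n → DegLt (scale c p) n
DegLt-scale c p d k n≤k = trans (coeff-scale c p k) (trans (cong (c *ℚ_) (d k n≤k)) (ℚₚ.*-zeroʳ c))

DegLt-shrink : ∀ p {m} → DegLt p (suc m) → coeff p m ≡ 0ℚ → DegLt p m
DegLt-shrink p d e k m≤k with m≤n⇒m<n∨m≡n m≤k
... | inj₁ m<k  = d k m<k
... | inj₂ refl = e

cancel-leading : ∀ q p m → DegLt q (suc m) → DegLt p (suc m) → coeff p m ≢ 0ℚ →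
  ∃[ c ] DegLt (q +P negP (scale c p)) m
cancel-leading q p m q-deg p-deg lead with ℚ-inverse (coeff p m) lead
... | b , b*p≡1 = c , DegLt-shrink (q +P negP (scale c p)) (DegLt-+ q (negP (scale c p)) q-deg (DegLt-scale (- 1ℚ) (scale c p) (DegLt-scale c p p-deg))) (begin
  coeff (q +P negP (scale c p)) m                 ≡⟨ coeff-+ q (negP (scale c p)) m ⟩
  coeff q m +ℚ coeff (negP (scale c p)) m         ≡⟨ cong (coeff q m +ℚ_) (trans (coeff-neg (scale c p) m) (cong -_ (coeff-scale c p m))) ⟩
  coeff q m +ℚ (- ((coeff q m *ℚ b) *ℚ coeff p m)) ≡⟨ cong (λ x → coeff q m +ℚ (- x)) (trans (ℚₚ.*-assoc (coeff q m) b (coeff p m))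
                                                       (trans (cong (coeff q m *ℚ_) b*p≡1) (ℚₚ.*-identityʳ (coeff q m)))) ⟩
  coeff q m +ℚ (- coeff q m)                      ≡⟨ ℚₚ.+-inverseʳ (coeff q m) ⟩
  0ℚ                                              ∎)
  where
  open ≡-Reasoning
  c = coeff q m *ℚ b

-- If f = s p + r, then a + x f = (x s) p + (a + x r). The new remainder has degree at most `m`, so
-- one multiple of `p` brings it back below.
divide : ∀ f p m → DegLt p (suc m) → coeff p m ≢ 0ℚ →
  Σ[ s ∈ Poly ] Σ[ r ∈ Poly ] (f ≋ ((s *P p) +P r)) × DegLt r m
divide []      p m p-deg lead = [] , [] , ≋-refl , λ k _ → refl
divide (a ∷ f) p m p-deg lead with divide f p m p-deg lead
... | s , r , f≋ , r-deg with cancel-leading (a ∷ r) p m (λ { (suc k) (s≤s m≤k) → r-deg k m≤k }) p-deg lead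
...   | c , r′-deg = c ∷ s , (a ∷ r) +P negP (scale c p) , eq , r′-deg
  where
  open ≋-Reasoning
  regroup : ∀ x y z → ((x +P y) +P (z +P negP x)) ≋ (y +P z)
  regroup = solve-∀ poly-ring
  eq : (a ∷ f) ≋ (((c ∷ s) *P p) +P ((a ∷ r) +P negP (scale c p)))
  eq = begin
    a ∷ f                                ≈⟨ ∷-cong (sym (ℚₚ.+-identityˡ a)) f≋ ⟩
    (0ℚ ∷ (s *P p)) +P (a ∷ r)           ≈⟨ regroup (scale c p) (0ℚ ∷ (s *P p)) (a ∷ r) ⟨
    ((c ∷ s) *P p) +P ((a ∷ r) +P negP (scale c p)) ∎

zero-or-coeff : ∀ p → p ≋ [] ⊎ (∃[ k ] coeff p k ≢ 0ℚ)
zero-or-coeff []      = inj₁ ≋-refl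
zero-or-coeff (a ∷ p) with a ≟ℚ 0ℚ | zero-or-coeff p
... | no a≢0  | _            = inj₂ (zero , a≢0)
... | yes _   | inj₂ (k , d) = inj₂ (suc k , d)
... | yes a≡0 | inj₁ p≋      = inj₁ (≋-trans (∷-cong a≡0 p≋) 0∷[]≋)

module Irreducible (φ : Poly) {n : ℕ} (irr : IrreducibleQ φ) (φ-deg : DegLt φ (suc n)) (lead : coeff φ n ≢ 0ℚ) where

  1≤n : 1 ≤ n
  1≤n with proj₁ irr
  ... | k , 1≤k , ck≢0 with k ≤? n
  ...   | yes k≤n = ≤-trans 1≤k k≤n
  ...   | no  k≰n = ⊥-elim (ck≢0 (φ-deg k (≰⇒> k≰n)))

  -- A constant cofactor would give φ a degree below n, against its leading coefficient.
  cofactor-nonconstant : ∀ s p {m} → φ ≋ (s *P p) → DegLt p m → m ≤ n → NonConstant s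
  cofactor-nonconstant []      p e p-deg m≤n = ⊥-elim (lead (at e n))
  cofactor-nonconstant (c ∷ s) p e p-deg m≤n with zero-or-coeff s
  ... | inj₂ (k , d) = suc k , s≤s z≤n , d
  ... | inj₁ s≋ = ⊥-elim (lead (trans (at e′ n) (DegLt-scale c p p-deg n m≤n)))
    where
    e′ : φ ≋ scale c p
    e′ = ≋-trans e (≋-trans (*P-congˡ p (∷-cong refl s≋)) (constP-*P c p))

  InvertibleMod : Poly → Set
  InvertibleMod p = Σ[ a ∈ Poly ] Σ[ b ∈ Poly ] (((a *P p) +P (b *P φ)) ≋ constP 1ℚ)

  -- Euclid's algorithm: dividing φ by a nonconstant p of smaller degree leaves a nonzero
  -- remainder, and an inverse of the remainder modulo φ yields one of p.
  nonzero-invertible : ∀ m p → suc m ≤ n → DegLt p (suc m) → coeff p m ≢ 0ℚ →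
    (∀ r → DegLt r m → r ≋ [] ⊎ InvertibleMod r) → InvertibleMod p
  nonzero-invertible zero p m<n d ne ih with ℚ-inverse (coeff p 0) ne
  ... | b , b*p≡1 = constP b , [] , ≋-trans (+P-identityʳ _) (≋-trans (constP-*P b p) (pw unit-coeff))
    where
    unit-coeff : scale b p ≈P constP 1ℚ
    unit-coeff zero    = trans (coeff-scale b p 0) b*p≡1
    unit-coeff (suc k) = DegLt-scale b p d (suc k) (s≤s z≤n)
  nonzero-invertible (suc m) p m<n d ne ih with divide φ p (suc m) d ne
  ... | s , r , φ≋ , r-deg with ih r r-deg
  ...   | inj₁ r≋ = ⊥-elim (proj₂ irr s p (at φ≋sp) (cofactor-nonconstant s p φ≋sp d m<n , (suc m , s≤s z≤n , ne)))
    where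
    φ≋sp : φ ≋ (s *P p)
    φ≋sp = ≋-trans φ≋ (≋-trans (+P-cong (≋-refl {s *P p}) r≋) (+P-identityʳ _))
  -- Obtained by substituting r = φ - s p into a r + b φ = 1.
  ...   | inj₂ (a , b , e) = negP (a *P s) , a +P b , (begin
    (negP (a *P s) *P p) +P ((a +P b) *P φ)
      ≈⟨ regroup₁ a s p b φ ⟩
    (negP (a *P (s *P p)) +P (a *P φ)) +P (b *P φ)
      ≈⟨ +P-cong (+P-cong (≋-refl {negP (a *P (s *P p))}) (*P-congʳ a φ≋)) (≋-refl {b *P φ}) ⟩
    (negP (a *P (s *P p)) +P (a *P ((s *P p) +P r))) +P (b *P φ)
      ≈⟨ regroup₂ a (s *P p) r (b *P φ) ⟩
    (a *P r) +P (b *P φ)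
      ≈⟨ e ⟩
    constP 1ℚ ∎)
    where
    open ≋-Reasoning
    regroup₁ : ∀ a s p b f → ((negP (a *P s) *P p) +P ((a +P b) *P f)) ≋ ((negP (a *P (s *P p)) +P (a *P f)) +P (b *P f))
    regroup₁ = solve-∀ poly-ring
    regroup₂ : ∀ a x r y → ((negP (a *P x) +P (a *P (x +P r))) +P y) ≋ ((a *P r) +P y)
    regroup₂ = solve-∀ poly-ring

  -- The induction on the degree bound: the bound drops if the top coefficient vanishes; otherwise
  -- the statement for smaller bounds is handed to the Euclidean step.
  zero-or-invertible : ∀ m p → m ≤ n → DegLt p m → p ≋ [] ⊎ InvertibleMod p
  zero-or-invertible zero    p m≤n d = inj₁ (pw λ k → d k z≤n)
  zero-or-invertible (suc m) p m<n d with coeff p m ≟ℚ 0ℚ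
  ... | yes e = zero-or-invertible m p (≤-trans (n≤1+n m) m<n) (DegLt-shrink p d e)
  ... | no ne = inj₂ (nonzero-invertible m p m<n d ne
    (λ r → zero-or-invertible m r (≤-trans (n≤1+n m) m<n)))

DegLt-tabulate : ∀ {m} (f : Vecℚ m) → DegLt (tabulate f) m
DegLt-tabulate {zero}  f k       _         = refl
DegLt-tabulate {suc m} f (suc k) (s≤s m≤k) = DegLt-tabulate (λ i → f (suc i)) k m≤k

coeff-tabulate : ∀ {m} (f : Vecℚ m) i → coeff (tabulate f) (toℕ i) ≡ f i
coeff-tabulate f zero    = refl
coeff-tabulate f (suc i) = coeff-tabulate (λ i → f (suc i)) i

-- The all-ones vector as a cyclic vector

ones : ∀ {n} → Vecℚ n
ones _ = 1ℚ

module Cyclic (φ : Poly) {n : ℕ} (irr : IrreducibleQ φ) (φ-deg : DegLt φ (suc n)) (lead : coeff φ n ≢ 0ℚ)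
  (A : Mat n n) (φA : ∀ i → Action.act A φ ones i ≡ 0ℚ) where

  open Irreducible φ irr φ-deg lead
  open Action A

  -- Apply a p + b φ = 1 to q(A)e. What is known is φ(A)e = 0, so q(A) is first commuted past φ(A).
  invertible-injective : ∀ p → InvertibleMod p → ∀ q → (∀ i → act p (act q ones) i ≡ 0ℚ) → ∀ i → act q ones i ≡ 0ℚ
  invertible-injective p (a , b , e) q pq i = begin
    act q ones i
      ≡⟨ trans (act-const 1ℚ (act q ones) i) (ℚₚ.*-identityˡ _) ⟨
    act (constP 1ℚ) (act q ones) i
      ≡⟨ act-≋ e (act q ones) i ⟨
    act ((a *P p) +P (b *P φ)) (act q ones) i
      ≡⟨ act-+P (a *P p) (b *P φ) (act q ones) i ⟩
    act (a *P p) (act q ones) i +ℚ act (b *P φ) (act q ones) i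
      ≡⟨ cong₂ _+ℚ_ (trans (act-*P a p (act q ones) i) (trans (act-cong a pq i) (act-0 a i)))
                    (trans (act-comm (b *P φ) q ones i) (trans (act-cong q (λ j → trans (act-*P b φ ones j)
                      (trans (act-cong b φA j) (act-0 b j))) i) (act-0 q i))) ⟩
    0ℚ ∎
    where open ≡-Reasoning

  -- There is a coordinate to look at because an irreducible φ is nonconstant, which gives n ≥ 1.
  ones-≢0 : (∀ i → act (constP 1ℚ) ones i ≡ 0ℚ) → ⊥
  ones-≢0 z with trans (sym (act-const 1ℚ ones (fromℕ< 1≤n))) (z (fromℕ< 1≤n))
  ... | ()

  -- Otherwise p is invertible modulo φ, and p(A)e = 0 would force e = 0. Equivalently, e, Ae, ...,
  -- Aⁿ⁻¹e are independent.
  annihilator : ∀ p → DegLt p n → (∀ i → act p ones i ≡ 0ℚ) → p ≋ []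
  annihilator p p-deg p1 with zero-or-invertible n p ≤-refl p-deg
  ... | inj₁ p≋  = p≋
  ... | inj₂ inv = ⊥-elim (ones-≢0 (invertible-injective p inv (constP 1ℚ) λ i →
    trans (act-cong p (λ j → act-const 1ℚ ones j) i) (p1 i)))

  no-zero-divisors : ∀ p q → DegLt p n → DegLt q n → (∀ i → act p (act q ones) i ≡ 0ℚ) → p ≋ [] ⊎ q ≋ []
  no-zero-divisors p q p-deg q-deg pq with zero-or-invertible n p ≤-refl p-deg
  ... | inj₁ p≋  = inj₁ p≋
  ... | inj₂ inv = inj₂ (annihilator q q-deg (invertible-injective p inv q pq))

  power : ℕ → Vecℚ n
  power zero    = ones
  power (suc k) = A · power k

  act-tabulate : ∀ {m} (f : Vecℚ m) i → Σℚ (λ j → f j *ℚ power (toℕ j) i) ≡ act (tabulate f) ones i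
  act-tabulate {zero}  f i = refl
  act-tabulate {suc m} f i = cong ((f zero *ℚ 1ℚ) +ℚ_) (begin
    Σℚ (λ j → f (suc j) *ℚ Σℚ (λ l → A i l *ℚ power (toℕ j) l))
      ≡⟨ ⟨⟩-cong {u = λ j → f (suc j)} (λ j → refl) (λ j → ⟨⟩-comm (A i) (power (toℕ j))) ⟩
    ⟨ (λ j → f (suc j)) , (λ j l → power (toℕ j) l) · A i ⟩
      -- Interchanges the sum over powers with the sum over coordinates: the powers Aʲe are the rows
      -- of a rectangular matrix.
      ≡⟨ ⟨⟩-adjoint (λ j l → power (toℕ j) l) (λ j → f (suc j)) (A i) ⟩
    ⟨ (λ l → Σℚ (λ j → power (toℕ j) l *ℚ f (suc j))) , A i ⟩
      ≡⟨ trans (⟨⟩-comm _ (A i)) (⟨⟩-cong {u = A i} (λ l → refl) (λ l →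
           trans (⟨⟩-comm (λ j → power (toℕ j) l) (λ j → f (suc j))) (act-tabulate (λ j → f (suc j)) l))) ⟩
    Σℚ (λ l → A i l *ℚ act (tabulate (λ j → f (suc j))) ones l) ∎)
    where open ≡-Reasoning

  -- The n + 1 vectors v, e, Ae, ..., Aⁿ⁻¹e are dependent. The weight of v is nonzero, since
  -- otherwise `annihilator` would make all weights zero, so the relation can be solved for v.
  cyclic : ∀ v → Σ[ p ∈ Poly ] DegLt p n × (∀ i → act p ones i ≡ v i)
  cyclic v with dependent n vs
    where
    vs : Fin (suc n) → Vecℚ n
    vs zero    = v
    vs (suc j) = power (toℕ j)
  ... | c , (k , ck≢0) , rel with ℚ-inverse (c zero) c₀≢0
    where
    p₀ = tabulate (λ j → c (suc j))
    c₀≢0 : c zero ≢ 0ℚ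
    c₀≢0 c₀≡0 = ck≢0 (all-zero k)
      where
      p₀≋[] : p₀ ≋ []
      p₀≋[] = annihilator p₀ (DegLt-tabulate (λ j → c (suc j))) λ i → begin
        act p₀ ones i                        ≡⟨ act-tabulate (λ j → c (suc j)) i ⟨
        S i                                  ≡⟨ ℚₚ.+-identityˡ (S i) ⟨
        0ℚ +ℚ S i                            ≡⟨ cong (_+ℚ S i) (trans (cong (_*ℚ v i) c₀≡0) (ℚₚ.*-zeroˡ (v i))) ⟨
        (c zero *ℚ v i) +ℚ S i               ≡⟨ rel i ⟩
        0ℚ                                   ∎
        where
        open ≡-Reasoning
        S : Vecℚ n
        S i = Σℚ (λ j → c (suc j) *ℚ power (toℕ j) i)
      all-zero : ∀ k → c k ≡ 0ℚ
      all-zero zero    = c₀≡0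
      all-zero (suc k) = trans (sym (coeff-tabulate (λ j → c (suc j)) k)) (at p₀≋[] (toℕ k))
  ... | b , bc₀≡1 = scale (- b) p₀ , DegLt-scale (- b) p₀ (DegLt-tabulate (λ j → c (suc j))) , λ i → begin
    act (scale (- b) p₀) ones i                 ≡⟨ act-scale (- b) p₀ ones i ⟩
    (- b) *ℚ act p₀ ones i                      ≡⟨ regroup b (c zero) (v i) (act p₀ ones i) ⟩
    ((b *ℚ c zero) *ℚ v i) +ℚ (- (b *ℚ ((c zero *ℚ v i) +ℚ act p₀ ones i)))
      ≡⟨ cong₂ _+ℚ_ (trans (cong (_*ℚ v i) bc₀≡1) (ℚₚ.*-identityˡ (v i)))
                    (cong (λ x → - (b *ℚ x)) (trans (cong ((c zero *ℚ v i) +ℚ_) (sym (act-tabulate (λ j → c (suc j)) i))) (rel i))) ⟩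
    v i +ℚ (- (b *ℚ 0ℚ))                        ≡⟨ trans (cong (λ x → v i +ℚ (- x)) (ℚₚ.*-zeroʳ b)) (ℚₚ.+-identityʳ (v i)) ⟩
    v i                                         ∎
    where
    open ≡-Reasoning
    p₀ = tabulate (λ j → c (suc j))
    regroup : ∀ b c v x → (- b) *ℚ x ≡ ((b *ℚ c) *ℚ v) +ℚ (- (b *ℚ ((c *ℚ v) +ℚ x)))
    regroup = solve-∀ ℚ-ring

-- Characteristic polynomials and moments

altΣ-coeff-zero : ∀ {n} (f : Row n) k → (∀ j → coeff (f j) k ≡ 0ℚ) → coeff (altΣP f) k ≡ 0ℚ
altΣ-coeff-zero {zero}  f k e = refl
altΣ-coeff-zero {suc n} f k e = trans (coeff-+ (f zero) (negP (altΣP λ j → f (suc j))) k)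
  (cong₂ _+ℚ_ (e zero) (trans (coeff-neg (altΣP λ j → f (suc j)) k)
                              (cong -_ (altΣ-coeff-zero (λ j → f (suc j)) k λ j → e (suc j)))))

linear : ℚ → ℚ → Poly
linear b a = b ∷ a ∷ []

coeff-linear-* : ∀ b a q k → coeff (linear b a *P q) (suc k) ≡ (b *ℚ coeff q (suc k)) +ℚ (a *ℚ coeff q k)
coeff-linear-* b a q k = trans (coeff-+ (scale b q) (0ℚ ∷ (constP a *P q)) (suc k))
  (cong₂ _+ℚ_ (coeff-scale b q (suc k)) (trans (at (constP-*P a q) k) (coeff-scale a q k)))

coeff-linear-*₀ : ∀ b a q → coeff (linear b a *P q) 0 ≡ b *ℚ coeff q 0
coeff-linear-*₀ b a q = trans (coeff-+ (scale b q) (0ℚ ∷ (constP a *P q)) 0)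
  (trans (cong (_+ℚ 0ℚ) (coeff-scale b q 0)) (ℚₚ.+-identityʳ _))

-- The entries of B + xA. General A is allowed because the minors of xI - A are no longer of the
-- form xI - A′.
pencil : ∀ {n} → Mat n n → Mat n n → PMat n n
pencil B A i j = linear (B i j) (A i j)

det-pencil-degree : ∀ {n} (B A : Mat n n) → DegLt (det (pencil B A)) (suc n)
det-pencil-degree {zero}  B A (suc k) _ = refl
det-pencil-degree {suc n} B A (suc k) (s≤s n<k) = altΣ-coeff-zero (λ j → pencil B A zero j *P minor j) (suc k) λ j → begin
  coeff (linear (B zero j) (A zero j) *P minor j) (suc k)
    ≡⟨ coeff-linear-* (B zero j) (A zero j) (minor j) k ⟩
  (B zero j *ℚ coeff (minor j) (suc k)) +ℚ (A zero j *ℚ coeff (minor j) k)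
    ≡⟨ cong₂ (λ x y → (B zero j *ℚ x) +ℚ (A zero j *ℚ y)) (minor-deg j (suc k) (m≤n⇒m≤1+n n<k)) (minor-deg j k n<k) ⟩
  (B zero j *ℚ 0ℚ) +ℚ (A zero j *ℚ 0ℚ)
    ≡⟨ cong₂ _+ℚ_ (ℚₚ.*-zeroʳ (B zero j)) (ℚₚ.*-zeroʳ (A zero j)) ⟩
  0ℚ ∎
  where
  open ≡-Reasoning
  minor : Row (suc n)
  minor j = det (del (below (pencil B A)) j)
  minor-deg : ∀ j → DegLt (minor j) (suc n)
  minor-deg j = det-pencil-degree (λ r c → B (suc r) (punchIn j c)) (λ r c → A (suc r) (punchIn j c))

-- Each term of the expansion has top coefficient `A zero j` times that of its minor, so only j = 0
-- survives. The hypothesis is pointwise because deleting a row and column of I gives I only up to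
-- `≈M`.
det-pencil-leading : ∀ {n} (B A : Mat n n) → A ≈M I → coeff (det (pencil B A)) n ≡ 1ℚ
det-pencil-leading {zero}  B A e = refl
det-pencil-leading {suc n} B A e = begin
  coeff (det (pencil B A)) (suc n)
    ≡⟨ trans (coeff-+ (term zero) (negP (altΣP λ j → term (suc j))) (suc n))
             (cong (coeff (term zero) (suc n) +ℚ_) (coeff-neg (altΣP λ j → term (suc j)) (suc n))) ⟩
  coeff (term zero) (suc n) +ℚ (- coeff (altΣP λ j → term (suc j)) (suc n))
    ≡⟨ cong₂ (λ x y → x +ℚ (- y)) (trans (top zero) (cong₂ _*ℚ_ (e zero zero)
         (det-pencil-leading (λ r c → B (suc r) (suc c)) (λ r c → A (suc r) (suc c))
           (λ r c → trans (e (suc r) (suc c)) (δ-suc r c)))))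
       (altΣ-coeff-zero (λ j → term (suc j)) (suc n) (λ j → trans (top (suc j))
         (trans (cong (_*ℚ coeff (minor (suc j)) n) (e zero (suc j))) (ℚₚ.*-zeroˡ (coeff (minor (suc j)) n))))) ⟩
  1ℚ ∎
  where
  open ≡-Reasoning
  minor term : Row (suc n)
  minor j = det (del (below (pencil B A)) j)
  term j = linear (B zero j) (A zero j) *P minor j
  top : ∀ j → coeff (term j) (suc n) ≡ A zero j *ℚ coeff (minor j) n
  top j = begin
    coeff (term j) (suc n)
      ≡⟨ coeff-linear-* (B zero j) (A zero j) (minor j) n ⟩
    (B zero j *ℚ coeff (minor j) (suc n)) +ℚ (A zero j *ℚ coeff (minor j) n)
      ≡⟨ cong (λ x → (B zero j *ℚ x) +ℚ (A zero j *ℚ coeff (minor j) n))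
           (det-pencil-degree (λ r c → B (suc r) (punchIn j c)) (λ r c → A (suc r) (punchIn j c)) (suc n) ≤-refl) ⟩
    (B zero j *ℚ 0ℚ) +ℚ (A zero j *ℚ coeff (minor j) n)
      ≡⟨ trans (cong (_+ℚ (A zero j *ℚ coeff (minor j) n)) (ℚₚ.*-zeroʳ (B zero j))) (ℚₚ.+-identityˡ _) ⟩
    A zero j *ℚ coeff (minor j) n ∎

charMat : ∀ {n} → Mat n n → PMat n n
charMat A = pencil (λ i j → - A i j) I

charMat-entry : ∀ {n} (A : Mat n n) i j → ((constP (δ i j) *P X) +P constP (- A i j)) ≋ charMat A i j
charMat-entry A i j = ∷-cong (constant (δ i j) (- A i j)) (∷-cong (ℚₚ.*-identityʳ (δ i j)) ≋-refl)
  where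
  constant : ∀ d a → ((d *ℚ 0ℚ) +ℚ 0ℚ) +ℚ a ≡ a
  constant = solve-∀ ℚ-ring

charPoly≋ : ∀ {n} (A : Mat n n) → charPoly A ≋ det (charMat A)
charPoly≋ A = det-cong (charMat-entry A)

charPoly-degree : ∀ {n} (A : Mat n n) → DegLt (charPoly A) (suc n)
charPoly-degree A = DegLt-cong {det (charMat A)} {charPoly A} (≋-sym (charPoly≋ A)) (det-pencil-degree (λ i j → - A i j) I)

charPoly-monic : ∀ {n} (A : Mat n n) → coeff (charPoly A) n ≡ 1ℚ
charPoly-monic {n} A = trans (at (charPoly≋ A) n) (det-pencil-leading (λ i j → - A i j) I (λ i j → refl))

-- Substitution and the complementary characteristic polynomial

compose : Poly → Poly → Poly
compose q []      = []
compose q (a ∷ p) = constP a +P (q *P compose q p)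

module Compose (y : Poly) where

  compose-+ : ∀ p q → compose y (p +P q) ≋ (compose y p +P compose y q)
  compose-+ []      q       = ≋-refl
  compose-+ (a ∷ p) []      = ≋-sym (+P-identityʳ _)
  compose-+ (a ∷ p) (b ∷ q) = ≋-trans (+P-cong (≋-refl {constP (a +ℚ b)}) (*P-congʳ y (compose-+ p q)))
    (regroup (constP a) (constP b) y (compose y p) (compose y q))
    where
    regroup : ∀ a b y p q → ((a +P b) +P (y *P (p +P q))) ≋ ((a +P (y *P p)) +P (b +P (y *P q)))
    regroup = solve-∀ poly-ring

  compose-scale : ∀ c p → compose y (scale c p) ≋ scale c (compose y p)
  compose-scale c []      = ≋-refl
  compose-scale c (a ∷ p) = begin
    constP (c *ℚ a) +P (y *P compose y (scale c p))
      ≈⟨ +P-cong (constP-*P c (constP a)) (*P-congʳ y (≋-trans (constP-*P c (compose y p)) (≋-sym (compose-scale c p)))) ⟨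
    (constP c *P constP a) +P (y *P (constP c *P compose y p))
      ≈⟨ regroup (constP c) (constP a) y (compose y p) ⟩
    constP c *P (constP a +P (y *P compose y p))
      ≈⟨ constP-*P c (constP a +P (y *P compose y p)) ⟩
    scale c (constP a +P (y *P compose y p)) ∎
    where
    open ≋-Reasoning
    regroup : ∀ c a y p → ((c *P a) +P (y *P (c *P p))) ≋ (c *P (a +P (y *P p)))
    regroup = solve-∀ poly-ring

  compose-* : ∀ p q → compose y (p *P q) ≋ (compose y p *P compose y q)
  compose-* []      q = ≋-refl
  compose-* (a ∷ p) q = begin
    compose y (scale a q +P (0ℚ ∷ (p *P q)))
      ≈⟨ compose-+ (scale a q) (0ℚ ∷ (p *P q)) ⟩
    compose y (scale a q) +P (constP 0ℚ +P (y *P compose y (p *P q)))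
      ≈⟨ +P-cong (≋-trans (compose-scale a q) (≋-sym (constP-*P a (compose y q)))) (+P-cong 0∷[]≋ (*P-congʳ y (compose-* p q))) ⟩
    (constP a *P compose y q) +P (y *P (compose y p *P compose y q))
      ≈⟨ regroup (constP a) y (compose y p) (compose y q) ⟩
    compose y (a ∷ p) *P compose y q ∎
    where
    open ≋-Reasoning
    regroup : ∀ a y p q → ((a *P q) +P (y *P (p *P q))) ≋ ((a +P (y *P p)) *P q)
    regroup = solve-∀ poly-ring

  compose-zero : ∀ p → p ≋ [] → compose y p ≋ []
  compose-zero []      e = ≋-refl
  compose-zero (a ∷ p) e = +P-cong (≋-trans (∷-cong (at e 0) ≋-refl) 0∷[]≋)
    (≋-trans (*P-congʳ y (compose-zero p (pw λ k → at e (suc k)))) (*P-[] y))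

  compose-cong : ∀ {p q} → p ≋ q → compose y p ≋ compose y q
  compose-cong {[]}    {q}     e = ≋-sym (compose-zero q (≋-sym e))
  compose-cong {a ∷ p} {[]}    e = compose-zero (a ∷ p) e
  compose-cong {a ∷ p} {b ∷ q} e = +P-cong (∷-cong (at e 0) ≋-refl) (*P-congʳ y (compose-cong (tail-≋ e)))

  compose-endo : IsEndomorphism (compose y)
  compose-endo = record
    { +-homo = compose-+
    ; *-homo = compose-*
    ; neg-homo = compose-scale (- 1ℚ)
    ; 0-homo = ≋-refl
    ; 1-homo = ≋-trans (+P-cong (≋-refl {constP 1ℚ}) (*P-[] y)) (+P-identityʳ _) }

  compose-linear : ∀ b a → compose y (linear b a) ≋ (constP b +P scale a y)
  compose-linear b a = +P-cong (≋-refl {constP b})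
    (≋-trans (*P-congʳ y (≋-trans (+P-cong (≋-refl {constP a}) (*P-[] y)) (+P-identityʳ (constP a))))
    (≋-trans (*P-comm y (constP a)) (constP-*P a y)))

-1-X : Poly
-1-X = linear (- 1ℚ) (- 1ℚ)

1ᵣ : ∀ {n} → Row n
1ᵣ _ = constP 1ℚ

-- Substituting −1 − x in xI − (J − I − A) gives −(xI − A + J).
complement-charPoly : ∀ {n} (A : Mat n n) →
  compose -1-X (charPoly (JIA A)) ≋ (sgn n *P (charPoly A +P ∂det (charMat A) 1ᵣ))
complement-charPoly {n} A = begin
  compose -1-X (charPoly (JIA A))
    ≈⟨ compose-cong (charPoly≋ (JIA A)) ⟩
  compose -1-X (det (charMat (JIA A)))
    ≈⟨ det-homo compose-endo (charMat (JIA A)) ⟩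
  det (λ i j → compose -1-X (charMat (JIA A) i j))
    ≈⟨ det-cong (λ i j → ≋-trans (compose-linear (- JIA A i j) (δ i j))
         (∷-cong (constant (δ i j) (A i j)) (∷-cong (ℚₚ.*-comm (δ i j) (- 1ℚ)) ≋-refl))) ⟩
  det (λ i j → negP (charMat A i j +P constP 1ℚ))
    ≈⟨ det-neg (λ i j → charMat A i j +P constP 1ℚ) ⟩
  sgn n *P det (λ i j → charMat A i j +P constP 1ℚ)
    ≈⟨ *P-congʳ (sgn n) (≋-trans (det-rank-one-update (charMat A) 1ᵣ) (+P-cong (≋-sym (charPoly≋ A)) ≋-refl)) ⟩
  sgn n *P (charPoly A +P ∂det (charMat A) 1ᵣ) ∎
  where
  open ≋-Reasoning
  open Compose -1-X
  expand : ∀ d a → (- ((1ℚ +ℚ (- d)) +ℚ (- a))) +ℚ (d *ℚ (- 1ℚ)) ≡ (- 1ℚ) *ℚ ((- a) +ℚ 1ℚ)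
  expand = solve-∀ ℚ-ring
  constant : ∀ d a → (- ((1ℚ -ℚ d) -ℚ a)) +ℚ (d *ℚ (- 1ℚ)) ≡ (- 1ℚ) *ℚ ((- a) +ℚ 1ℚ)
  constant d a = expand d a

-- Multiplying `complement-charPoly` by (-1)ⁿ once more removes the sign; subtracting the shared
-- characteristic polynomial isolates the derivative.
∂det-charMat-invariant : ∀ {n} (A B : Mat n n) → GenCospectral A B →
  ∂det (charMat A) 1ᵣ ≋ ∂det (charMat B) 1ᵣ
∂det-charMat-invariant {n} A B (φ≈ , φ̄≈) = begin
  ∂A                                             ≈⟨ recover (sgn n) (charPoly A) ∂A (sgn² n) ⟩
  (sgn n *P (sgn n *P (charPoly A +P ∂A))) +P negP (charPoly A)
    ≈⟨ +P-cong (*P-congʳ (sgn n) same) (negP-cong (pw φ≈)) ⟩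
  (sgn n *P (sgn n *P (charPoly B +P ∂B))) +P negP (charPoly B)
    ≈⟨ recover (sgn n) (charPoly B) ∂B (sgn² n) ⟨
  ∂B                                             ∎
  where
  open ≋-Reasoning
  ∂A = ∂det (charMat A) 1ᵣ
  ∂B = ∂det (charMat B) 1ᵣ
  same : (sgn n *P (charPoly A +P ∂A)) ≋ (sgn n *P (charPoly B +P ∂B))
  same = ≋-trans (≋-sym (complement-charPoly A))
    (≋-trans (Compose.compose-cong -1-X {charPoly (JIA A)} {charPoly (JIA B)} (pw φ̄≈)) (complement-charPoly B))
  regroup₁ : ∀ p d → d ≋ ((constP 1ℚ *P (p +P d)) +P negP p)
  regroup₁ = solve-∀ poly-ring
  recover : ∀ s p d → (s *P s) ≋ constP 1ℚ → d ≋ ((s *P (s *P (p +P d))) +P negP p)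
  recover s p d e = ≋-trans (regroup₁ p d) (+P-cong (≋-trans (≋-sym (*P-congˡ (p +P d) e)) (*P-assoc s s (p +P d))) ≋-refl)

-- Coefficient vectors of the adjugate solution, and moments

coeff-ΣP : ∀ {n} (f : Row n) k → coeff (ΣP f) k ≡ Σℚ (λ j → coeff (f j) k)
coeff-ΣP {zero}  f k = refl
coeff-ΣP {suc n} f k = trans (coeff-+ (f zero) (ΣP λ j → f (suc j)) k)
  (cong (coeff (f zero) k +ℚ_) (coeff-ΣP (λ j → f (suc j)) k))

coeff-beyond : ∀ p → DegLt p (length p)
coeff-beyond []      k       _       = refl
coeff-beyond (a ∷ p) (suc k) (s≤s l) = coeff-beyond p k l

-- Supplies an index from which all coefficient vectors of `solution` vanish, where the downward
-- recurrence starts.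
common-degree : ∀ {n} (f : Row n) → ∃[ K ] (∀ j → DegLt (f j) K)
common-degree {zero}  f = 0 , λ ()
common-degree {suc n} f with common-degree (λ j → f (suc j))
... | K , d = length (f zero) ⊔ K , λ
  { zero    k l → coeff-beyond (f zero) k (≤-trans (m≤m⊔n (length (f zero)) K) l)
  ; (suc j) k l → d j k (≤-trans (m≤n⊔m (length (f zero)) K) l) }

coeff-drop : ∀ m p k → coeff (drop m p) k ≡ coeff p (m + k)
coeff-drop zero    p       k = refl
coeff-drop (suc m) []      k = refl
coeff-drop (suc m) (a ∷ p) k = coeff-drop m p k

module _ {n} (A : Mat n n) where
  open Action A

  -- The recurrence is Horner's rule run from high indices to low. Past the end of the list it reads
  -- U m = A U (m + 1), which carries zero down from index `K`.
  horner : ∀ p (U : ℕ → Vecℚ n) → (∀ m i → U m i ≡ (coeff p m *ℚ 1ℚ) +ℚ (A · U (suc m)) i) →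
    ∀ K → (∀ m → K ≤ m → ∀ i → U m i ≡ 0ℚ) → ∀ i → U 0 i ≡ act p ones i
  horner []      U rec zero    vanish i = vanish 0 z≤n i
  horner []      U rec (suc K) vanish i = trans (rec 0 i) (cong₂ _+ℚ_ (ℚₚ.*-zeroˡ 1ℚ) (Σ-zero λ j →
    trans (cong (A i j *ℚ_) (horner [] (λ m → U (suc m)) (λ m → rec (suc m)) K (λ m l → vanish (suc m) (s≤s l)) j))
          (ℚₚ.*-zeroʳ (A i j))))
  horner (a ∷ p) U rec K       vanish i = trans (rec 0 i) (cong ((a *ℚ 1ℚ) +ℚ_) (Σ-cong λ j →
    cong (A i j *ℚ_) (horner p (λ m → U (suc m)) (λ m → rec (suc m)) K (λ m l → vanish (suc m) (m≤n⇒m≤1+n l)) j)))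

  -- Entry j of adj (xI − A) applied to the all-ones vector
  solution : Row n
  solution j = ∂det (charMat A) (unit j)

  -- The coefficient vectors of the solution, shifted by one so that entry 0 is zero
  solutionCoeffs : ℕ → Vecℚ n
  solutionCoeffs zero    j = 0ℚ
  solutionCoeffs (suc m) j = coeff (solution j) m

  solution-equation : ∀ i → charPoly A ≋ ΣP (λ j → charMat A i j *P solution j)
  solution-equation i = ≋-trans (charPoly≋ A) (≋-trans (≋-sym (∂det-row (charMat A) i))
    (linear-expansion (∂det-linear (charMat A)) (charMat A i)))

  -- The coefficient of xᵐ in (xI - A)w = φe. The shift in `solutionCoeffs` makes m = 0, where xw
  -- contributes nothing, an instance of the same formula.
  solutionCoeffs-rec : ∀ m i →
    solutionCoeffs m i ≡ (coeff (charPoly A) m *ℚ 1ℚ) +ℚ (A · solutionCoeffs (suc m)) i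
  solutionCoeffs-rec zero i = sym (begin
    (coeff (charPoly A) 0 *ℚ 1ℚ) +ℚ S
      ≡⟨ cong (λ x → (x *ℚ 1ℚ) +ℚ S) (trans (at (solution-equation i) 0) (coeff-ΣP (λ j → charMat A i j *P solution j) 0)) ⟩
    (Σℚ (λ j → coeff (charMat A i j *P solution j) 0) *ℚ 1ℚ) +ℚ S
      ≡⟨ cong (λ x → (x *ℚ 1ℚ) +ℚ S) (trans (Σ-cong λ j → trans (coeff-linear-*₀ (- A i j) (δ i j) (solution j))
           (neg (A i j) (coeff (solution j) 0))) (Σ-*ˡ (- 1ℚ) (λ j → A i j *ℚ coeff (solution j) 0))) ⟩
    (((- 1ℚ) *ℚ S) *ℚ 1ℚ) +ℚ S
      ≡⟨ cancel S ⟩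
    0ℚ ∎)
    where
    open ≡-Reasoning
    S = (A · solutionCoeffs 1) i
    neg : ∀ a x → (- a) *ℚ x ≡ (- 1ℚ) *ℚ (a *ℚ x)
    neg = solve-∀ ℚ-ring
    cancel : ∀ s → (((- 1ℚ) *ℚ s) *ℚ 1ℚ) +ℚ s ≡ 0ℚ
    cancel = solve-∀ ℚ-ring
  solutionCoeffs-rec (suc m) i = sym (begin
    (coeff (charPoly A) (suc m) *ℚ 1ℚ) +ℚ S
      ≡⟨ cong (λ x → (x *ℚ 1ℚ) +ℚ S) (trans (at (solution-equation i) (suc m)) (coeff-ΣP (λ j → charMat A i j *P solution j) (suc m))) ⟩
    (Σℚ (λ j → coeff (charMat A i j *P solution j) (suc m)) *ℚ 1ℚ) +ℚ S
      ≡⟨ cong (λ x → (x *ℚ 1ℚ) +ℚ S) (trans (Σ-cong λ j → trans (coeff-linear-* (- A i j) (δ i j) (solution j) m)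
           (cong (_+ℚ (δ i j *ℚ coeff (solution j) m)) (neg (A i j) (coeff (solution j) (suc m)))))
         (trans (Σ-+ (λ j → (- 1ℚ) *ℚ (A i j *ℚ coeff (solution j) (suc m))) (λ j → δ i j *ℚ coeff (solution j) m))
           (cong₂ _+ℚ_ (Σ-*ˡ (- 1ℚ) (λ j → A i j *ℚ coeff (solution j) (suc m))) (Σ-δ i (λ j → coeff (solution j) m))))) ⟩
    ((((- 1ℚ) *ℚ S) +ℚ coeff (solution i) m) *ℚ 1ℚ) +ℚ S
      ≡⟨ cancel S (coeff (solution i) m) ⟩
    coeff (solution i) m ∎)
    where
    open ≡-Reasoning
    S = (A · solutionCoeffs (suc (suc m))) i
    neg : ∀ a x → (- a) *ℚ x ≡ (- 1ℚ) *ℚ (a *ℚ x)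
    neg = solve-∀ ℚ-ring
    cancel : ∀ s x → ((((- 1ℚ) *ℚ s) +ℚ x) *ℚ 1ℚ) +ℚ s ≡ x
    cancel = solve-∀ ℚ-ring

  -- The coefficient vectors are the partial results of evaluating φ(A)e by Horner's rule. Leaving
  -- `φ` free up to `≋` lets two cospectral matrices use one coefficient list.
  solutionCoeffs-act : ∀ φ → charPoly A ≋ φ → ∀ m i → solutionCoeffs m i ≡ act (drop m φ) ones i
  solutionCoeffs-act φ e m i = trans (cong (λ k → solutionCoeffs k i) (sym (+-comm m 0)))
    (horner (drop m φ) (λ k → solutionCoeffs (m + k)) rec (suc K) vanish i)
    where
    K = proj₁ (common-degree solution)
    rec : ∀ k i → solutionCoeffs (m + k) i ≡ (coeff (drop m φ) k *ℚ 1ℚ) +ℚ (A · solutionCoeffs (m + suc k)) i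
    rec k i rewrite +-suc m k = trans (solutionCoeffs-rec (m + k) i)
      (cong (λ x → (x *ℚ 1ℚ) +ℚ (A · solutionCoeffs (suc (m + k))) i) (trans (at e (m + k)) (sym (coeff-drop m φ k))))
    vanish : ∀ k → suc K ≤ k → ∀ i → solutionCoeffs (m + k) i ≡ 0ℚ
    vanish (suc k) (s≤s K≤k) i rewrite +-suc m k =
      proj₂ (common-degree solution) i (m + k) (≤-trans K≤k (m≤n+m k m))

  -- The last Horner step yields entry 0 of `solutionCoeffs`, which is zero by definition.
  cayley-hamilton : ∀ φ → charPoly A ≋ φ → ∀ i → act φ ones i ≡ 0ℚ
  cayley-hamilton φ e i = sym (solutionCoeffs-act φ e 0 i)

  moment : Poly → ℚ
  moment p = ⟨ ones , act p ones ⟩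

  -- By linearity of `∂det` in the row, its value on the all-ones row is the sum of the entries of
  -- `solution`, that is eᵀw. These moments are therefore invariants of generalized cospectrality.
  moment-drop : ∀ φ → charPoly A ≋ φ → ∀ m → moment (drop (suc m) φ) ≡ coeff (∂det (charMat A) 1ᵣ) m
  moment-drop φ e m = begin
    ⟨ ones , act (drop (suc m) φ) ones ⟩
      ≡⟨ ⟨⟩-cong {u = ones} (λ i → refl) (λ i → solutionCoeffs-act φ e (suc m) i) ⟨
    Σℚ (λ j → 1ℚ *ℚ coeff (solution j) m)
      ≡⟨ Σ-cong (λ j → trans (at (constP-*P 1ℚ (solution j)) m) (coeff-scale 1ℚ (solution j) m)) ⟨
    Σℚ (λ j → coeff (constP 1ℚ *P solution j) m)
      ≡⟨ coeff-ΣP (λ j → constP 1ℚ *P solution j) m ⟨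
    coeff (ΣP (λ j → constP 1ℚ *P solution j)) m
      ≡⟨ at (linear-expansion (∂det-linear (charMat A)) 1ᵣ) m ⟨
    coeff (∂det (charMat A) 1ᵣ) m ∎
    where open ≡-Reasoning

  moment-+ : ∀ p q → moment (p +P q) ≡ moment p +ℚ moment q
  moment-+ p q = trans (⟨⟩-cong {u = ones} (λ i → refl) (act-+P p q ones)) (⟨⟩-+ʳ ones (act p ones) (act q ones))

  moment-scale : ∀ c p → moment (scale c p) ≡ c *ℚ moment p
  moment-scale c p = trans (⟨⟩-cong {u = ones} (λ i → refl) (act-scale c p ones)) (⟨⟩-*ʳ ones c (act p ones))

  moment-≋ : ∀ {p q} → p ≋ q → moment p ≡ moment q
  moment-≋ e = ⟨⟩-cong {u = ones} (λ i → refl) (act-≋ e ones)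

  moment-* : Symmetric A → ∀ p q → ⟨ act p ones , act q ones ⟩ ≡ moment (p *P q)
  moment-* A-sym p q = trans (act-adjoint A-sym p ones (act q ones))
    (⟨⟩-cong {u = ones} (λ i → refl) (λ i → sym (act-*P p q ones i)))

  moment-multiple : ∀ φ → charPoly A ≋ φ → ∀ s → moment (s *P φ) ≡ 0ℚ
  moment-multiple φ e s = Σ-zero λ i → trans (cong (1ℚ *ℚ_) (trans (act-*P s φ ones i)
    (trans (act-cong s (cayley-hamilton φ e) i) (act-0 s i)))) (ℚₚ.*-zeroʳ 1ℚ)

-- The polynomials drop m φ have leading coefficient that of φ and run through all degrees
-- below deg φ, so they span everything modulo φ.
moments-agree : ∀ {n} (A B : Mat n n) → GenCospectral A B → ∀ q → moment A q ≡ moment B q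
moments-agree {n} A B cosp = agree
  where
  open ≡-Reasoning
  φ = charPoly A
  φB : charPoly B ≋ φ
  φB = ≋-sym (pw (proj₁ cosp))
  lead : coeff φ n ≢ 0ℚ
  lead e with trans (sym (charPoly-monic A)) e
  ... | ()

  agree-drop : ∀ m → moment A (drop (suc m) φ) ≡ moment B (drop (suc m) φ)
  agree-drop m = trans (moment-drop A φ ≋-refl m)
    (trans (at (∂det-charMat-invariant A B cosp) m) (sym (moment-drop B φ φB m)))

  agree-below : ∀ i m → i + m ≡ n → ∀ r → DegLt r i → moment A r ≡ moment B r
  agree-below zero    m e r d = trans (moment-≋ A r≋) (sym (moment-≋ B r≋))
    where
    r≋ : r ≋ []
    r≋ = pw λ k → d k z≤n
  agree-below (suc i) m e r d = begin
    moment A r                                ≡⟨ split A ⟩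
    moment A r′ +ℚ (c *ℚ moment A ψ)          ≡⟨ cong₂ (λ x y → x +ℚ (c *ℚ y))
                                                  (agree-below i (suc m) (trans (+-suc i m) e) r′ (proj₂ cancelled)) (agree-drop m) ⟩
    moment B r′ +ℚ (c *ℚ moment B ψ)          ≡⟨ split B ⟨
    moment B r                                ∎
    where
    -- Since suc i + m = n, ψ has degree exactly i and the leading coefficient of φ, so a multiple
    -- of it clears the top coefficient of r.
    ψ = drop (suc m) φ
    m+i : suc m + i ≡ n
    m+i = trans (cong suc (+-comm m i)) e
    cancelled = cancel-leading r ψ i d
      (λ k i<k → trans (coeff-drop (suc m) φ k) (charPoly-degree A _
        (subst (λ x → suc x ≤ suc (m + k)) m+i (s≤s (subst (_≤ m + k) (+-suc m i) (+-monoʳ-≤ m i<k))))))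
      (λ z → lead (trans (cong (coeff φ) (sym m+i)) (trans (sym (coeff-drop (suc m) φ i)) z)))
    c = proj₁ cancelled
    r′ = r +P negP (scale c ψ)
    regroup : ∀ r x → r ≋ ((r +P negP x) +P x)
    regroup = solve-∀ poly-ring
    split : ∀ (C : Mat n n) → moment C r ≡ moment C r′ +ℚ (c *ℚ moment C ψ)
    split C = trans (moment-≋ C (regroup r (scale c ψ)))
      (trans (moment-+ C r′ (scale c ψ)) (cong (moment C r′ +ℚ_) (moment-scale C c ψ)))

  agree : ∀ q → moment A q ≡ moment B q
  agree q with divide q φ n (charPoly-degree A) lead
  -- Multiples of φ have moment zero for both matrices, so only the remainder counts.
  ... | s , r , q≋ , r-deg = trans (reduce A ≋-refl) (trans (agree-below n 0 (+-comm n 0) r r-deg) (sym (reduce B φB)))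
    where
    reduce : ∀ (C : Mat n n) → charPoly C ≋ φ → moment C q ≡ moment C r
    reduce C e = trans (moment-≋ C q≋) (trans (moment-+ C (s *P φ) r)
      (trans (cong (_+ℚ moment C r) (moment-multiple C φ e s)) (ℚₚ.+-identityˡ _)))

-- The orthogonal intertwiner

reflect-scale : ∀ c p → reflect (scale c p) ≋ scale c (reflect p)
reflect-scale c []      = ≋-refl
reflect-scale c (a ∷ p) = ∷-cong refl (begin
  negP (reflect (scale c p))      ≈⟨ negP-cong (reflect-scale c p) ⟩
  negP (scale c (reflect p))      ≈⟨ scale-assoc (- 1ℚ) c (reflect p) ⟩
  scale ((- 1ℚ) *ℚ c) (reflect p) ≈⟨ scale-cong (ℚₚ.*-comm (- 1ℚ) c) ≋-refl ⟩
  scale (c *ℚ (- 1ℚ)) (reflect p) ≈⟨ scale-assoc c (- 1ℚ) (reflect p) ⟨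
  scale c (negP (reflect p))      ∎)
  where open ≋-Reasoning

reflect-involutive : ∀ p → reflect (reflect p) ≋ p
reflect-involutive []      = ≋-refl
reflect-involutive (a ∷ p) = ∷-cong refl
  (≋-trans (negP-cong (≋-trans (reflect-scale (- 1ℚ) (reflect p)) (negP-cong (reflect-involutive p)))) (neg-neg p))
  where
  neg-neg : ∀ p → negP (negP p) ≋ p
  neg-neg = solve-∀ poly-ring

difference-zero : ∀ p q → (p +P negP q) ≋ [] → p ≋ q
difference-zero p q e = ≋-trans (shift p q) (+P-cong e (≋-refl {q}))
  where
  shift : ∀ p q → p ≋ ((p +P negP q) +P q)
  shift = solve-∀ poly-ring

sum-zero : ∀ p q → (p +P q) ≋ [] → p ≋ negP q
sum-zero p q e = ≋-trans (shift p q) (+P-cong e (≋-refl {negP q}))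
  where
  shift : ∀ p q → p ≋ ((p +P q) +P negP q)
  shift = solve-∀ poly-ring

Anticommutes : ∀ {n} → Vecℚ n → Mat n n → Set
Anticommutes s A = ∀ i j → s i *ℚ A i j ≡ - (A i j *ℚ s j)

SignIntertwining : ∀ {m n} → Vecℚ m → Mat m n → Vecℚ n → Set
SignIntertwining s Q t =
  (∀ i j → s i *ℚ Q i j ≡ Q i j *ℚ t j) ⊎ (∀ i j → s i *ℚ Q i j ≡ - (Q i j *ℚ t j))

SignedSimilarity : ∀ {m n} → Mat m m → Mat n n → Vecℚ m → Vecℚ n → Set
SignedSimilarity {m} {n} A B s t = Σ[ Q ∈ Mat m n ]
  (Regular Q × Orthogonal Q × (((Q ᵀ) ⊗ A) ⊗ Q) ≈M B × SignIntertwining s Q t)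

IsCyclic : ∀ {n} → Mat n n → Set
IsCyclic {n} A = (v : Vecℚ n) → Σ[ p ∈ Poly ] DegLt p n × (∀ i → Action.act A p ones i ≡ v i)

NoZeroDivisors : ∀ {n} → Mat n n → Set
NoZeroDivisors {n} A = ∀ p q → DegLt p n → DegLt q n → (∀ i → Action.act A p (Action.act A q ones) i ≡ 0ℚ) → p ≋ [] ⊎ q ≋ []

module Intertwiner {n} (A B : Mat n n) (A-sym : Symmetric A) (B-sym : Symmetric B)
  (moments : ∀ q → moment A q ≡ moment B q)
  (cyclicA : IsCyclic A) (cyclicB : IsCyclic B) (integral : NoZeroDivisors A) where

  open ≡-Reasoning
  open Action using (act; act-const; act-X; act-*P; act-scale; act-≋; act-cong)

  cA cB : Poly → Vecℚ n
  cA p = act A p ones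
  cB p = act B p ones

  isometry : ∀ p q → ⟨ cA p , cA q ⟩ ≡ ⟨ cB p , cB q ⟩
  isometry p q = trans (moment-* A A-sym p q) (trans (moments (p *P q)) (sym (moment-* B B-sym p q)))

  basisA basisB : Fin n → Poly
  basisA i = proj₁ (cyclicA (I i))
  basisB i = proj₁ (cyclicB (I i))

  -- Writes a coordinate as an inner product of two vectors of the form p(A)e, the shape that
  -- `isometry` can transfer to B.
  pairA : ∀ i p → ⟨ cA (basisA i) , cA p ⟩ ≡ cA p i
  pairA i p = trans (⟨⟩-cong {v = cA p} (proj₂ (proj₂ (cyclicA (I i)))) (λ _ → refl)) (Σ-δ i (cA p))

  pairB : ∀ i p → ⟨ cB (basisB i) , cB p ⟩ ≡ cB p i
  pairB i p = trans (⟨⟩-cong {v = cB p} (proj₂ (proj₂ (cyclicB (I i)))) (λ _ → refl)) (Σ-δ i (cB p))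

  -- Q maps p(B)e to p(A)e.
  Q : Mat n n
  Q i j = cA (basisB j) i

  -- The transpose of Q is the reverse map p(A)e ↦ p(B)e. Knowing the rows as vectors p(B)e turns
  -- each application of Q into an inner product that `isometry` evaluates.
  Q-row : ∀ i j → Q i j ≡ cB (basisA i) j
  Q-row i j = begin
    cA (basisB j) i                       ≡⟨ pairA i (basisB j) ⟨
    ⟨ cA (basisA i) , cA (basisB j) ⟩     ≡⟨ ⟨⟩-comm (cA (basisA i)) (cA (basisB j)) ⟩
    ⟨ cA (basisB j) , cA (basisA i) ⟩     ≡⟨ isometry (basisB j) (basisA i) ⟩
    ⟨ cB (basisB j) , cB (basisA i) ⟩     ≡⟨ pairB j (basisA i) ⟩
    cB (basisA i) j                       ∎

  Q-maps : ∀ p i → (Q · cB p) i ≡ cA p i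
  Q-maps p i = begin
    ⟨ Q i , cB p ⟩                 ≡⟨ ⟨⟩-cong {v = cB p} (Q-row i) (λ _ → refl) ⟩
    ⟨ cB (basisA i) , cB p ⟩       ≡⟨ isometry (basisA i) p ⟨
    ⟨ cA (basisA i) , cA p ⟩       ≡⟨ pairA i p ⟩
    cA p i                         ∎

  Q-regular : Regular Q
  Q-regular i = begin
    Σℚ (λ j → Q i j)               ≡⟨ Σ-cong (λ j → trans (cong (Q i j *ℚ_) (act-const B 1ℚ ones j)) (ℚₚ.*-identityʳ (Q i j))) ⟨
    (Q · cB (constP 1ℚ)) i         ≡⟨ Q-maps (constP 1ℚ) i ⟩
    cA (constP 1ℚ) i               ≡⟨ act-const A 1ℚ ones i ⟩
    1ℚ                             ∎

  Q-orthogonal : Orthogonal Q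
  Q-orthogonal =
    (λ i j → begin
      ⟨ cA (basisB i) , cA (basisB j) ⟩ ≡⟨ isometry (basisB i) (basisB j) ⟩
      ⟨ cB (basisB i) , cB (basisB j) ⟩ ≡⟨ pairB i (basisB j) ⟩
      cB (basisB j) i                   ≡⟨ proj₂ (proj₂ (cyclicB (I j))) i ⟩
      δ j i                             ≡⟨ δ-sym j i ⟩
      δ i j                             ∎) ,
    (λ i j → begin
      ⟨ Q i , Q j ⟩                     ≡⟨ ⟨⟩-cong (Q-row i) (Q-row j) ⟩
      ⟨ cB (basisA i) , cB (basisA j) ⟩ ≡⟨ isometry (basisA i) (basisA j) ⟨
      ⟨ cA (basisA i) , cA (basisA j) ⟩ ≡⟨ pairA i (basisA j) ⟩
      cA (basisA j) i                   ≡⟨ proj₂ (proj₂ (cyclicA (I j))) i ⟩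
      δ j i                             ≡⟨ δ-sym j i ⟩
      δ i j                             ∎)

  -- Entry (i, j) is the inner product of column i of Q with A times column j. Absorbing A into the
  -- polynomial as a factor x lets `isometry` replace it by B.
  Q-conjugates : (((Q ᵀ) ⊗ A) ⊗ Q) ≈M B
  Q-conjugates i j = begin
    Σℚ (λ l → Σℚ (λ k → Q k i *ℚ A k l) *ℚ Q l j)
      ≡⟨ ⟨⟩-cong {v = cA (basisB j)} (λ l → ⟨⟩-comm (λ k → Q k i) (λ k → A k l)) (λ l → refl) ⟩
    ⟨ (A ᵀ) · cA (basisB i) , cA (basisB j) ⟩
      ≡⟨ ⟨⟩-adjoint A (cA (basisB i)) (cA (basisB j)) ⟨
    ⟨ cA (basisB i) , A · cA (basisB j) ⟩
      ≡⟨ ⟨⟩-cong {u = cA (basisB i)} (λ _ → refl) (act-X A (basisB j) ones) ⟨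
    ⟨ cA (basisB i) , cA (0ℚ ∷ basisB j) ⟩
      ≡⟨ isometry (basisB i) (0ℚ ∷ basisB j) ⟩
    ⟨ cB (basisB i) , cB (0ℚ ∷ basisB j) ⟩
      ≡⟨ pairB i (0ℚ ∷ basisB j) ⟩
    cB (0ℚ ∷ basisB j) i
      ≡⟨ act-X B (basisB j) ones i ⟩
    ⟨ B i , cB (basisB j) ⟩
      ≡⟨ trans (⟨⟩-comm (B i) (cB (basisB j))) (⟨⟩-cong {v = B i} (proj₂ (proj₂ (cyclicB (I j)))) (λ _ → refl)) ⟩
    ⟨ δ j , B i ⟩
      ≡⟨ Σ-δ j (B i) ⟩
    B i j ∎

  module _ (s t : Vecℚ n) (s² : ∀ i → s i *ℚ s i ≡ 1ℚ) (t² : ∀ i → t i *ℚ t i ≡ 1ℚ)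
    (sA : Anticommutes s A) (tB : Anticommutes t B) where

    f g : Poly
    f = proj₁ (cyclicA s)
    g = proj₁ (cyclicB t)

    -- With U the diagonal matrix of `u` and u = h(C)e: U q(C)e = q(-C)Ue = q(-C)h(C)e.
    sign-on-orbit : ∀ (C : Mat n n) (u : Vecℚ n) → Anticommutes u C → ∀ h → (∀ i → act C h ones i ≡ u i) →
      ∀ q i → u i *ℚ act C q ones i ≡ act C (reflect q *P h) ones i
    sign-on-orbit C u uC h h≡u q i = begin
      u i *ℚ act C q ones i                             ≡⟨ sign-act C u uC q ones i ⟩
      act C (reflect q) (λ j → u j *ℚ 1ℚ) i             ≡⟨ act-cong C (reflect q) (λ j → trans (h≡u j) (sym (ℚₚ.*-identityʳ (u j)))) i ⟨
      act C (reflect q) (act C h ones) i                ≡⟨ act-*P C (reflect q) h ones i ⟨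
      act C (reflect q *P h) ones i                     ∎

    -- Insert U² = I between eᵀ and q(C)e, and give one factor U to each side.
    moment-reflect : ∀ (C : Mat n n) (C-sym : Symmetric C) (u : Vecℚ n) → (∀ i → u i *ℚ u i ≡ 1ℚ) → Anticommutes u C →
      ∀ h → (∀ i → act C h ones i ≡ u i) → ∀ q → moment C q ≡ moment C (h *P (reflect q *P h))
    moment-reflect C C-sym u u² uC h h≡u q = begin
      Σℚ (λ i → 1ℚ *ℚ act C q ones i)                   ≡⟨ Σ-cong (λ i → trans (cong (_*ℚ act C q ones i) (sym (u² i)))
                                                             (ℚₚ.*-assoc (u i) (u i) (act C q ones i))) ⟩
      ⟨ u , (λ i → u i *ℚ act C q ones i) ⟩             ≡⟨ ⟨⟩-cong (λ i → sym (h≡u i)) (sign-on-orbit C u uC h h≡u q) ⟩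
      ⟨ act C h ones , act C (reflect q *P h) ones ⟩    ≡⟨ moment-* C C-sym h (reflect q *P h) ⟩
      moment C (h *P (reflect q *P h))                  ∎

    f²-g² : ∀ i → act A (f +P negP g) (cA (f +P g)) i ≡ 0ℚ
    f²-g² i = begin
      act A (f +P negP g) (cA (f +P g)) i      ≡⟨ act-*P A (f +P negP g) (f +P g) ones i ⟨
      cA ((f +P negP g) *P (f +P g)) i         ≡⟨ pairA i ((f +P negP g) *P (f +P g)) ⟨
      ⟨ cA r , cA ((f +P negP g) *P (f +P g)) ⟩ ≡⟨ moment-* A A-sym r ((f +P negP g) *P (f +P g)) ⟩
      moment A (r *P ((f +P negP g) *P (f +P g))) ≡⟨ moment-≋ A (≋-trans (expand r f g)
            (+P-cong (*P-congʳ f (*P-congˡ f (≋-sym (reflect-involutive r))))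
                     (negP-cong (*P-congʳ g (*P-congˡ g (≋-sym (reflect-involutive r))))))) ⟩
      moment A ((f *P (reflect q *P f)) +P negP (g *P (reflect q *P g)))
        ≡⟨ trans (moment-+ A (f *P (reflect q *P f)) (negP (g *P (reflect q *P g))))
                 (cong (moment A (f *P (reflect q *P f)) +ℚ_) (moment-scale A (- 1ℚ) (g *P (reflect q *P g)))) ⟩
      moment A (f *P (reflect q *P f)) +ℚ ((- 1ℚ) *ℚ moment A (g *P (reflect q *P g)))
        ≡⟨ cong₂ (λ x y → x +ℚ ((- 1ℚ) *ℚ y))
             (sym (moment-reflect A A-sym s s² sA f (proj₂ (proj₂ (cyclicA s))) q))
             (trans (moments (g *P (reflect q *P g)))
             (trans (sym (moment-reflect B B-sym t t² tB g (proj₂ (proj₂ (cyclicB t))) q))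
                    (sym (moments q)))) ⟩
      moment A q +ℚ ((- 1ℚ) *ℚ moment A q)     ≡⟨ cancel (moment A q) ⟩
      0ℚ                                       ∎
      where
      r = basisA i
      -- Chosen so that reflecting `q` returns `r`: the reflected moments of `q` then become those
      -- of r f² and r g².
      q = reflect r
      expand : ∀ r f g → (r *P ((f +P negP g) *P (f +P g))) ≋ ((f *P (r *P f)) +P negP (g *P (r *P g)))
      expand = solve-∀ poly-ring
      cancel : ∀ x → x +ℚ ((- 1ℚ) *ℚ x) ≡ 0ℚ
      cancel = solve-∀ ℚ-ring

    f≋±g : f ≋ g ⊎ f ≋ negP g
    f≋±g = Sum.map (difference-zero f g) (sum-zero f g) (integral (f +P negP g) (f +P g)
      (DegLt-+ f (negP g) f-deg (DegLt-scale (- 1ℚ) g g-deg)) (DegLt-+ f g f-deg g-deg) f²-g²)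
      where
      f-deg = proj₁ (proj₂ (cyclicA s))
      g-deg = proj₁ (proj₂ (cyclicB t))

    sQ : ∀ i j → s i *ℚ Q i j ≡ cA (reflect (basisB j) *P f) i
    sQ i j = sign-on-orbit A s sA f (proj₂ (proj₂ (cyclicA s))) (basisB j) i

    -- This is entry i of QT applied to the j-th basis vector. T sends that vector to another of the
    -- form p(B)e, and Q then carries it to p(A)e.
    Qt : ∀ i j → Q i j *ℚ t j ≡ cA (reflect (basisB j) *P g) i
    Qt i j = begin
      Q i j *ℚ t j                                      ≡⟨ Σ-δ j (λ l → Q i l *ℚ t l) ⟨
      Σℚ (λ l → δ j l *ℚ (Q i l *ℚ t l))                ≡⟨ Σ-cong (λ l → trans (regroup (δ j l) (Q i l) (t l))
            (cong (Q i l *ℚ_) (trans (cong (t l *ℚ_) (sym (proj₂ (proj₂ (cyclicB (I j))) l)))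
              (sign-on-orbit B t tB g (proj₂ (proj₂ (cyclicB t))) (basisB j) l)))) ⟩
      (Q · cB (reflect (basisB j) *P g)) i              ≡⟨ Q-maps (reflect (basisB j) *P g) i ⟩
      cA (reflect (basisB j) *P g) i                    ∎
      where
      regroup : ∀ d q t → d *ℚ (q *ℚ t) ≡ q *ℚ (t *ℚ d)
      regroup = solve-∀ ℚ-ring

    Q-signs : SignIntertwining s Q t
    Q-signs = Sum.map commute anticommute f≋±g
      where
      commute : f ≋ g → ∀ i j → s i *ℚ Q i j ≡ Q i j *ℚ t j
      commute e i j = begin
        s i *ℚ Q i j                                     ≡⟨ sQ i j ⟩
        cA (reflect (basisB j) *P f) i                   ≡⟨ act-≋ A (*P-congʳ (reflect (basisB j)) e) ones i ⟩
        cA (reflect (basisB j) *P g) i                   ≡⟨ Qt i j ⟨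
        Q i j *ℚ t j                                     ∎
      pull : ∀ r g → (r *P negP g) ≋ negP (r *P g)
      pull = solve-∀ poly-ring
      neg : ∀ x → (- 1ℚ) *ℚ x ≡ - x
      neg = solve-∀ ℚ-ring
      anticommute : f ≋ negP g → ∀ i j → s i *ℚ Q i j ≡ - (Q i j *ℚ t j)
      anticommute e i j = begin
        s i *ℚ Q i j                                     ≡⟨ sQ i j ⟩
        cA (reflect (basisB j) *P f) i                   ≡⟨ act-≋ A (≋-trans (*P-congʳ (reflect (basisB j)) e)
                                                                      (pull (reflect (basisB j)) g)) ones i ⟩
        cA (negP (reflect (basisB j) *P g)) i            ≡⟨ act-scale A (- 1ℚ) (reflect (basisB j) *P g) ones i ⟩
        (- 1ℚ) *ℚ cA (reflect (basisB j) *P g) i         ≡⟨ neg (cA (reflect (basisB j) *P g) i) ⟩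
        - cA (reflect (basisB j) *P g) i                 ≡⟨ cong -_ (Qt i j) ⟨
        - (Q i j *ℚ t j)                                 ∎

-- The sizes n₁ + n₂ and m₁ + m₂ agree only propositionally. With variables in their place the
-- equation can be matched with `refl`, and A and B act on one space.
intertwiner : ∀ {m n} → m ≡ n → (A : Mat m m) (B : Mat n n) → Symmetric A → Symmetric B →
  GenCospectral A B → IrreducibleQ (charPoly A) →
  (s : Vecℚ m) (t : Vecℚ n) → (∀ i → s i *ℚ s i ≡ 1ℚ) → (∀ i → t i *ℚ t i ≡ 1ℚ) →
  Anticommutes s A → Anticommutes t B → SignedSimilarity A B s t
intertwiner {n = n} refl A B A-sym B-sym cosp irr s t s² t² sA tB =
  Q , Q-regular , Q-orthogonal , Q-conjugates , Q-signs s t s² t² sA tB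
  where
  φ : Poly
  φ = charPoly A
  lead : coeff φ n ≢ 0ℚ
  lead e with trans (sym (charPoly-monic A)) e
  ... | ()
  module CA = Cyclic φ irr (charPoly-degree A) lead A (cayley-hamilton A φ ≋-refl)
  module CB = Cyclic φ irr (charPoly-degree A) lead B (cayley-hamilton B φ (≋-sym (pw (proj₁ cosp))))
  open Intertwiner A B A-sym B-sym (moments-agree A B cosp) CA.cyclic CB.cyclic CA.no-zero-divisors

-- Block structure

Σ-ones-nonneg : ∀ n → 0ℚ ≤ℚ Σℚ {n} (λ _ → 1ℚ)
Σ-ones-nonneg zero    = ℚₚ.≤-refl
Σ-ones-nonneg (suc n) = ℚₚ.+-mono-≤ (ℚₚ.nonNegative⁻¹ 1ℚ) (Σ-ones-nonneg n)

Σ-ones-suc : ∀ n → 0ℚ ≢ 1ℚ +ℚ Σℚ {n} (λ _ → 1ℚ)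
Σ-ones-suc n e = ℚₚ.<-irrefl e (ℚₚ.+-mono-<-≤ (ℚₚ.positive⁻¹ 1ℚ) (Σ-ones-nonneg n))

-- Characteristic zero of ℚ, obtained from its order: a sum of ones is nonnegative, so one more
-- makes it positive.
Σ-ones-injective : ∀ m n → Σℚ {m} (λ _ → 1ℚ) ≡ Σℚ {n} (λ _ → 1ℚ) → m ≡ n
Σ-ones-injective zero    zero    e = refl
Σ-ones-injective zero    (suc n) e = ⊥-elim (Σ-ones-suc n e)
Σ-ones-injective (suc m) zero    e = ⊥-elim (Σ-ones-suc m (sym e))
Σ-ones-injective (suc m) (suc n) e = cong suc (Σ-ones-injective m n
  (trans (cancel (Σℚ {m} (λ _ → 1ℚ))) (trans (cong ((- 1ℚ) +ℚ_) e) (sym (cancel (Σℚ {n} (λ _ → 1ℚ)))))))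
  where
  cancel : ∀ x → x ≡ (- 1ℚ) +ℚ (1ℚ +ℚ x)
  cancel = solve-∀ ℚ-ring

-- Both dimensions equal the sum of the squares of all entries.
orthogonal-square : ∀ {m n} (Q : Mat m n) → Orthogonal Q → m ≡ n
orthogonal-square {m} {n} Q (QᵀQ , QQᵀ) = Σ-ones-injective m n (begin
  Σℚ {m} (λ _ → 1ℚ)                        ≡⟨ Σ-cong (λ i → trans (QQᵀ i i) (δ-diag i)) ⟨
  Σℚ (λ i → Σℚ (λ l → Q i l *ℚ Q i l))     ≡⟨ Σ-swap (λ i l → Q i l *ℚ Q i l) ⟩
  Σℚ (λ l → Σℚ (λ i → Q i l *ℚ Q i l))     ≡⟨ Σ-cong (λ l → trans (QᵀQ l l) (δ-diag l)) ⟩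
  Σℚ {n} (λ _ → 1ℚ)                        ∎)
  where open ≡-Reasoning

-- One side of a bipartition and its complement, without fixing which comes first. With `leftPart`
-- and `rightPart`, the single module `Corner` then yields the blocks of both forms of Q.
record Parts (N a b : ℕ) : Set where
  field
    part     : Fin a → Fin N
    rest     : Fin b → Fin N
    Σ-parts  : ∀ (f : Vecℚ N) → Σℚ f ≡ Σℚ (λ i → f (part i)) +ℚ Σℚ (λ i → f (rest i))
    δ-part   : ∀ i j → δ (part i) (part j) ≡ δ i j

Σ-split : ∀ a b (f : Vecℚ (a + b)) → Σℚ f ≡ Σℚ (λ i → f (i ↑ˡ b)) +ℚ Σℚ (λ i → f (a ↑ʳ i))
Σ-split zero    b f = sym (ℚₚ.+-identityˡ (Σℚ f))
Σ-split (suc a) b f = trans (cong (f zero +ℚ_) (Σ-split a b (λ i → f (suc i))))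
  (sym (ℚₚ.+-assoc (f zero) (Σℚ (λ i → f (suc (i ↑ˡ b)))) (Σℚ (λ i → f (suc (a ↑ʳ i))))))

δ-↑ˡ : ∀ {a} b (i j : Fin a) → δ (i ↑ˡ b) (j ↑ˡ b) ≡ δ i j
δ-↑ˡ b zero    zero    = refl
δ-↑ˡ b zero    (suc j) = refl
δ-↑ˡ b (suc i) zero    = refl
δ-↑ˡ b (suc i) (suc j) = trans (δ-suc (i ↑ˡ b) (j ↑ˡ b)) (trans (δ-↑ˡ b i j) (sym (δ-suc i j)))

δ-↑ʳ : ∀ a {b} (i j : Fin b) → δ (a ↑ʳ i) (a ↑ʳ j) ≡ δ i j
δ-↑ʳ zero    i j = refl
δ-↑ʳ (suc a) i j = trans (δ-suc (a ↑ʳ i) (a ↑ʳ j)) (δ-↑ʳ a i j)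

leftPart : ∀ a b → Parts (a + b) a b
leftPart a b = record { part = _↑ˡ b ; rest = a ↑ʳ_ ; Σ-parts = Σ-split a b ; δ-part = δ-↑ˡ b }

rightPart : ∀ a b → Parts (a + b) b a
rightPart a b = record { part = a ↑ʳ_ ; rest = _↑ˡ b
  ; Σ-parts = λ f → trans (Σ-split a b f) (ℚₚ.+-comm (Σℚ (λ i → f (i ↑ˡ b))) (Σℚ (λ i → f (a ↑ʳ i))))
  ; δ-part = δ-↑ʳ a }

module Corner {N N′ a b a′ b′} (R : Parts N a b) (C : Parts N′ a′ b′) (Q : Mat N N′)
  (row-zero : ∀ i j → Q (Parts.part R i) (Parts.rest C j) ≡ 0ℚ)
  (col-zero : ∀ i j → Q (Parts.rest R i) (Parts.part C j) ≡ 0ℚ) where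

  open Parts R using () renaming (part to ι; rest to κ; Σ-parts to Σ-rows; δ-part to δ-ι)
  open Parts C using () renaming (part to ι′; rest to κ′; Σ-parts to Σ-cols; δ-part to δ-ι′)

  corner : Mat a a′
  corner i j = Q (ι i) (ι′ j)

  corner-regular : Regular Q → Regular corner
  corner-regular reg i = begin
    Σℚ (λ j → Q (ι i) (ι′ j))
      ≡⟨ ℚₚ.+-identityʳ _ ⟨
    Σℚ (λ j → Q (ι i) (ι′ j)) +ℚ 0ℚ
      ≡⟨ cong (Σℚ (λ j → Q (ι i) (ι′ j)) +ℚ_) (Σ-zero (row-zero i)) ⟨
    Σℚ (λ j → Q (ι i) (ι′ j)) +ℚ Σℚ (λ j → Q (ι i) (κ′ j))
      ≡⟨ Σ-cols (Q (ι i)) ⟨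
    Σℚ (Q (ι i))
      ≡⟨ reg (ι i) ⟩
    1ℚ ∎
    where open ≡-Reasoning

  corner-orthogonal : Orthogonal Q → Orthogonal corner
  corner-orthogonal (QᵀQ , QQᵀ) =
    (λ i j → begin
      Σℚ (λ l → Q (ι l) (ι′ i) *ℚ Q (ι l) (ι′ j))
        ≡⟨ ℚₚ.+-identityʳ _ ⟨
      Σℚ (λ l → Q (ι l) (ι′ i) *ℚ Q (ι l) (ι′ j)) +ℚ 0ℚ
        ≡⟨ cong (Σℚ (λ l → Q (ι l) (ι′ i) *ℚ Q (ι l) (ι′ j)) +ℚ_) (Σ-zero λ l →
             trans (cong (_*ℚ Q (κ l) (ι′ j)) (col-zero l i)) (ℚₚ.*-zeroˡ (Q (κ l) (ι′ j)))) ⟨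
      Σℚ (λ l → Q (ι l) (ι′ i) *ℚ Q (ι l) (ι′ j)) +ℚ Σℚ (λ l → Q (κ l) (ι′ i) *ℚ Q (κ l) (ι′ j))
        ≡⟨ Σ-rows (λ l → Q l (ι′ i) *ℚ Q l (ι′ j)) ⟨
      Σℚ (λ l → Q l (ι′ i) *ℚ Q l (ι′ j))
        ≡⟨ QᵀQ (ι′ i) (ι′ j) ⟩
      δ (ι′ i) (ι′ j)
        ≡⟨ δ-ι′ i j ⟩
      δ i j ∎) ,
    (λ i j → begin
      Σℚ (λ l → Q (ι i) (ι′ l) *ℚ Q (ι j) (ι′ l))
        ≡⟨ ℚₚ.+-identityʳ _ ⟨
      Σℚ (λ l → Q (ι i) (ι′ l) *ℚ Q (ι j) (ι′ l)) +ℚ 0ℚ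
        ≡⟨ cong (Σℚ (λ l → Q (ι i) (ι′ l) *ℚ Q (ι j) (ι′ l)) +ℚ_) (Σ-zero λ l →
             trans (cong (_*ℚ Q (ι j) (κ′ l)) (row-zero i l)) (ℚₚ.*-zeroˡ (Q (ι j) (κ′ l)))) ⟨
      Σℚ (λ l → Q (ι i) (ι′ l) *ℚ Q (ι j) (ι′ l)) +ℚ Σℚ (λ l → Q (ι i) (κ′ l) *ℚ Q (ι j) (κ′ l))
        ≡⟨ Σ-cols (λ l → Q (ι i) l *ℚ Q (ι j) l) ⟨
      Σℚ (λ l → Q (ι i) l *ℚ Q (ι j) l)
        ≡⟨ QQᵀ (ι i) (ι j) ⟩
      δ (ι i) (ι j)
        ≡⟨ δ-ι i j ⟩
      δ i j ∎)
    where open ≡-Reasoning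

block-≈ : ∀ {m₁ m₂ n₁ n₂} (Q : Mat (m₁ + m₂) (n₁ + n₂))
  (A : Mat m₁ n₁) (B : Mat m₁ n₂) (C : Mat m₂ n₁) (D : Mat m₂ n₂) →
  (∀ r c → Q (r ↑ˡ m₂) (c ↑ˡ n₂) ≡ A r c) → (∀ r c → Q (r ↑ˡ m₂) (n₁ ↑ʳ c) ≡ B r c) →
  (∀ r c → Q (m₁ ↑ʳ r) (c ↑ˡ n₂) ≡ C r c) → (∀ r c → Q (m₁ ↑ʳ r) (n₁ ↑ʳ c) ≡ D r c) →
  Q ≈M block A B C D
block-≈ {m₁} {m₂} {n₁} {n₂} Q A B C D a b c d i j with splitAt m₁ i in eᵢ | splitAt n₁ j in eⱼ
... | inj₁ r | inj₁ k = trans (sym (cong₂ Q (splitAt⁻¹-↑ˡ eᵢ) (splitAt⁻¹-↑ˡ eⱼ))) (a r k)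
... | inj₁ r | inj₂ k = trans (sym (cong₂ Q (splitAt⁻¹-↑ˡ eᵢ) (splitAt⁻¹-↑ʳ eⱼ))) (b r k)
... | inj₂ r | inj₁ k = trans (sym (cong₂ Q (splitAt⁻¹-↑ʳ {m₁} eᵢ) (splitAt⁻¹-↑ˡ eⱼ))) (c r k)
... | inj₂ r | inj₂ k = trans (sym (cong₂ Q (splitAt⁻¹-↑ʳ {m₁} eᵢ) (splitAt⁻¹-↑ʳ {n₁} eⱼ))) (d r k)

-- Bipartition signs and the two block forms

bipAdj-symmetric : ∀ {n₁ n₂} (M : Mat n₁ n₂) → Symmetric (bipAdj M)
bipAdj-symmetric {n₁} M i j with splitAt n₁ i | splitAt n₁ j
... | inj₁ r | inj₁ c = refl
... | inj₁ r | inj₂ c = refl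
... | inj₂ r | inj₁ c = refl
... | inj₂ r | inj₂ c = refl

sideSign : ∀ {a b} → Fin a ⊎ Fin b → ℚ
sideSign (inj₁ _) = 1ℚ
sideSign (inj₂ _) = - 1ℚ

signs : ∀ a b → Vecℚ (a + b)
signs a b i = sideSign (splitAt a i)

signs-square : ∀ a b i → signs a b i *ℚ signs a b i ≡ 1ℚ
signs-square a b i with splitAt a i
... | inj₁ _ = refl
... | inj₂ _ = refl

signs-left : ∀ a b i → signs a b (i ↑ˡ b) ≡ 1ℚ
signs-left a b i = cong sideSign (splitAt-↑ˡ a i b)

signs-right : ∀ a b i → signs a b (a ↑ʳ i) ≡ - 1ℚ
signs-right a b i = cong sideSign (splitAt-↑ʳ a b i)

bipAdj-anticommutes : ∀ {n₁ n₂} (M : Mat n₁ n₂) → Anticommutes (signs n₁ n₂) (bipAdj M)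
bipAdj-anticommutes {n₁} M i j with splitAt n₁ i | splitAt n₁ j
... | inj₁ r | inj₁ c = refl
... | inj₁ r | inj₂ c = lemma (M r c)
  where
  lemma : ∀ x → 1ℚ *ℚ x ≡ - (x *ℚ (- 1ℚ))
  lemma = solve-∀ ℚ-ring
... | inj₂ r | inj₁ c = lemma (M c r)
  where
  lemma : ∀ x → (- 1ℚ) *ℚ x ≡ - (x *ℚ 1ℚ)
  lemma = solve-∀ ℚ-ring
... | inj₂ r | inj₂ c = refl

opposite-signs-zero : ∀ x → x ≡ - x → x ≡ 0ℚ
opposite-signs-zero x e = trans (half x) (trans (cong (λ y → ½ *ℚ (x +ℚ y)) e) (vanish x))
  where
  half : ∀ x → x ≡ ½ *ℚ (x +ℚ x)
  half = solve-∀ ℚ-ring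
  vanish : ∀ x → ½ *ℚ (x +ℚ (- x)) ≡ 0ℚ
  vanish = solve-∀ ℚ-ring

module _ {n₁ n₂ m₁ m₂} (Q : Mat (n₁ + n₂) (m₁ + m₂)) where

  DiagonalForm AntidiagonalForm : Set
  DiagonalForm = Σ[ Q₁ ∈ Mat n₁ m₁ ] Σ[ Q₂ ∈ Mat n₂ m₂ ]
    (n₁ ≡ m₁ × n₂ ≡ m₂ × Regular Q₁ × Orthogonal Q₁ × Regular Q₂ × Orthogonal Q₂ × Q ≈M block Q₁ O O Q₂)
  AntidiagonalForm = Σ[ Q₁ ∈ Mat n₁ m₂ ] Σ[ Q₂ ∈ Mat n₂ m₁ ]
    (n₁ ≡ m₂ × n₂ ≡ m₁ × Regular Q₁ × Orthogonal Q₁ × Regular Q₂ × Orthogonal Q₂ × Q ≈M block O Q₁ Q₂ O)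

  private
    s = signs n₁ n₂
    t = signs m₁ m₂

  module _ (reg : Regular Q) (orth : Orthogonal Q) where

    -- On the off-diagonal blocks the row and column signs differ, which forces x = -x for every
    -- entry. The surviving corners are orthogonal, and this gives the equalities of sizes.
    diagonal : (∀ i j → s i *ℚ Q i j ≡ Q i j *ℚ t j) → DiagonalForm
    diagonal comm = L.corner , R.corner , orthogonal-square L.corner (L.corner-orthogonal orth)
      , orthogonal-square R.corner (R.corner-orthogonal orth)
      , L.corner-regular reg , L.corner-orthogonal orth , R.corner-regular reg , R.corner-orthogonal orth
      , block-≈ Q L.corner O O R.corner (λ _ _ → refl) upper lower (λ _ _ → refl)
      where
      upper : ∀ i j → Q (i ↑ˡ n₂) (m₁ ↑ʳ j) ≡ 0ℚ
      upper i j = opposite-signs-zero x (begin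
        x                                     ≡⟨ ℚₚ.*-identityˡ x ⟨
        1ℚ *ℚ x                               ≡⟨ cong (_*ℚ x) (signs-left n₁ n₂ i) ⟨
        s (i ↑ˡ n₂) *ℚ x                      ≡⟨ comm (i ↑ˡ n₂) (m₁ ↑ʳ j) ⟩
        x *ℚ t (m₁ ↑ʳ j)                      ≡⟨ cong (x *ℚ_) (signs-right m₁ m₂ j) ⟩
        x *ℚ (- 1ℚ)                           ≡⟨ neg x ⟩
        - x                                   ∎)
        where
        open ≡-Reasoning
        x = Q (i ↑ˡ n₂) (m₁ ↑ʳ j)
        neg : ∀ x → x *ℚ (- 1ℚ) ≡ - x
        neg = solve-∀ ℚ-ring
      lower : ∀ i j → Q (n₁ ↑ʳ i) (j ↑ˡ m₂) ≡ 0ℚ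
      lower i j = opposite-signs-zero x (begin
        x                                     ≡⟨ ℚₚ.*-identityʳ x ⟨
        x *ℚ 1ℚ                               ≡⟨ cong (x *ℚ_) (signs-left m₁ m₂ j) ⟨
        x *ℚ t (j ↑ˡ m₂)                      ≡⟨ comm (n₁ ↑ʳ i) (j ↑ˡ m₂) ⟨
        s (n₁ ↑ʳ i) *ℚ x                      ≡⟨ cong (_*ℚ x) (signs-right n₁ n₂ i) ⟩
        (- 1ℚ) *ℚ x                           ≡⟨ neg x ⟩
        - x                                   ∎)
        where
        open ≡-Reasoning
        x = Q (n₁ ↑ʳ i) (j ↑ˡ m₂)
        neg : ∀ x → (- 1ℚ) *ℚ x ≡ - x
        neg = solve-∀ ℚ-ring
      module L = Corner (leftPart n₁ n₂) (leftPart m₁ m₂) Q upper lower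
      module R = Corner (rightPart n₁ n₂) (rightPart m₁ m₂) Q lower upper

    -- Here the blocks with equal row and column signs vanish, so each side of one graph is matched
    -- with the opposite side of the other.
    antidiagonal : (∀ i j → s i *ℚ Q i j ≡ - (Q i j *ℚ t j)) → AntidiagonalForm
    antidiagonal anti = L.corner , R.corner , orthogonal-square L.corner (L.corner-orthogonal orth)
      , orthogonal-square R.corner (R.corner-orthogonal orth)
      , L.corner-regular reg , L.corner-orthogonal orth , R.corner-regular reg , R.corner-orthogonal orth
      , block-≈ Q O L.corner R.corner O upper (λ _ _ → refl) (λ _ _ → refl) lower
      where
      upper : ∀ i j → Q (i ↑ˡ n₂) (j ↑ˡ m₂) ≡ 0ℚ
      upper i j = opposite-signs-zero x (begin
        x                                     ≡⟨ ℚₚ.*-identityˡ x ⟨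
        1ℚ *ℚ x                               ≡⟨ cong (_*ℚ x) (signs-left n₁ n₂ i) ⟨
        s (i ↑ˡ n₂) *ℚ x                      ≡⟨ anti (i ↑ˡ n₂) (j ↑ˡ m₂) ⟩
        - (x *ℚ t (j ↑ˡ m₂))                  ≡⟨ cong (λ y → - (x *ℚ y)) (signs-left m₁ m₂ j) ⟩
        - (x *ℚ 1ℚ)                           ≡⟨ cong -_ (ℚₚ.*-identityʳ x) ⟩
        - x                                   ∎)
        where
        open ≡-Reasoning
        x = Q (i ↑ˡ n₂) (j ↑ˡ m₂)
      lower : ∀ i j → Q (n₁ ↑ʳ i) (m₁ ↑ʳ j) ≡ 0ℚ
      lower i j = opposite-signs-zero x (begin
        x                                     ≡⟨ neg₁ x ⟩
        - ((- 1ℚ) *ℚ x)                       ≡⟨ cong (λ y → - (y *ℚ x)) (signs-right n₁ n₂ i) ⟨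
        - (s (n₁ ↑ʳ i) *ℚ x)                  ≡⟨ cong -_ (anti (n₁ ↑ʳ i) (m₁ ↑ʳ j)) ⟩
        - (- (x *ℚ t (m₁ ↑ʳ j)))              ≡⟨ cong (λ y → - (- (x *ℚ y))) (signs-right m₁ m₂ j) ⟩
        - (- (x *ℚ (- 1ℚ)))                   ≡⟨ neg₂ x ⟩
        - x                                   ∎)
        where
        open ≡-Reasoning
        x = Q (n₁ ↑ʳ i) (m₁ ↑ʳ j)
        neg₁ : ∀ x → x ≡ - ((- 1ℚ) *ℚ x)
        neg₁ = solve-∀ ℚ-ring
        neg₂ : ∀ x → - (- (x *ℚ (- 1ℚ))) ≡ - x
        neg₂ = solve-∀ ℚ-ring
      module L = Corner (leftPart n₁ n₂) (rightPart m₁ m₂) Q upper lower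
      module R = Corner (rightPart n₁ n₂) (leftPart m₁ m₂) Q lower upper

theorem3p1 : (n n₁ n₂ m₁ m₂ : ℕ) → n₁ + n₂ ≡ n → m₁ + m₂ ≡ n →
    (M : Mat n₁ n₂) (M~ : Mat m₁ m₂) → SignMat M → SignMat M~ →
    GenCospectral (bipAdj M) (bipAdj M~) →
    IrreducibleQ (charPoly (bipAdj M)) →
    Σ[ Q ∈ Mat (n₁ + n₂) (m₁ + m₂) ]
    (Regular Q × Orthogonal Q × (((Q ᵀ) ⊗ bipAdj M) ⊗ Q) ≈M bipAdj M~ ×
    ((Σ[ Q₁ ∈ Mat n₁ m₁ ] Σ[ Q₂ ∈ Mat n₂ m₂ ]
    (n₁ ≡ m₁ × n₂ ≡ m₂ × Regular Q₁ × Orthogonal Q₁ × Regular Q₂ × Orthogonal Q₂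
    × Q ≈M block Q₁ O O Q₂))
    ⊎ (Σ[ Q₁ ∈ Mat n₁ m₂ ] Σ[ Q₂ ∈ Mat n₂ m₁ ]
    (n₁ ≡ m₂ × n₂ ≡ m₁ × Regular Q₁ × Orthogonal Q₁ × Regular Q₂ × Orthogonal Q₂
    × Q ≈M block O Q₁ Q₂ O))))
theorem3p1 n n₁ n₂ m₁ m₂ n₁+n₂≡n m₁+m₂≡n M M~ _ _ cosp irr =
  split-blocks (intertwiner (trans n₁+n₂≡n (sym m₁+m₂≡n)) (bipAdj M) (bipAdj M~)
    (bipAdj-symmetric M) (bipAdj-symmetric M~) cosp irr (signs n₁ n₂) (signs m₁ m₂)
    (signs-square n₁ n₂) (signs-square m₁ m₂) (bipAdj-anticommutes M) (bipAdj-anticommutes M~))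
  where
  split-blocks : SignedSimilarity (bipAdj M) (bipAdj M~) (signs n₁ n₂) (signs m₁ m₂) →
    Σ[ Q ∈ Mat (n₁ + n₂) (m₁ + m₂) ]
    (Regular Q × Orthogonal Q × (((Q ᵀ) ⊗ bipAdj M) ⊗ Q) ≈M bipAdj M~ × (DiagonalForm Q ⊎ AntidiagonalForm Q))
  split-blocks (Q , reg , orth , conj , signed) =
    Q , reg , orth , conj , Sum.map (diagonal Q reg orth) (antidiagonal Q reg orth) signed
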